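{- Let $s$ be a normalized fully ternary string of length $n$. Then $d_{\rm g}(s)=n-2$ if $s$ is bad and $d_{\rm g}(s)=n-3$ otherwise. Moreover, there is a polynomial-time algorithm that, given a ternary string, computes a sequence of $d_{\rm g}(s)$ flips grouping it (i.e. transforming its normalization into a string whose length equals its number of distinct symbols).
   Context: Strings are finite words over $\{0,1,2,\dots\}$. A string is \emph{normalized} if no two adjacent symbols are equal; the \emph{normalization} of a string replaces every maximal run of identical symbols by a single copy. A string is \emph{fully $k$-ary} if the set of symbols occurring in it is exactly $\{0,\dots,k-1\}$; fully ternary means fully $3$-ary. For a normalized string $s=s_1\cdots s_n$ and $1\le i\le n$, the flip $f^{(i)}(s)$ is the normalization of $s_i\cdots s_1 s_{i+1}\cdots s_n$. The grouping distance $d_{\rm g}(s)$ of a normalized fully $k$-ary string is the minimum number of flips needed to transform $s$ into a string of length $k$. Regular-expression notation: $w^i$ is $i$ repetitions of $w$, $w^*$ is zero or more, $w^+$ one or more, $w^{\ge 2}$ two or more repetitions; $\{a,b\}$ denotes a single symbol that is either $a$ or $b$ (chosen independently at each occurrence). A normalized fully ternary string is \emph{bad} (for grouping) if, after some relabelling (bijection) of the symbols $\{0,1,2\}$, it is of one of the following types: (I) $0(12)^{\ge 2}$ or $02(12)^+$; (II) $(\{0,1\}2)^+$ or $(2\{0,1\})^+2$; (III) $0(21)^+02(12)^*$; (IV) one of the eight strings $210212$, $021012$, $0120212$, $1201212$, $02101212$, $20210212$, $020210212$, $120120212$. All other normalized fully ternary strings are \emph{good}. -}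

module Defs where

open import Data.Fin.Base using (Fin; toℕ; _↑ˡ_)
open import Data.Fin.Patterns using (0F; 1F; 2F)
open import Data.Fin.Permutation using (Permutation′; _⟨$⟩ʳ_)
open import Data.Fin.Properties using (≤-decTotalOrder)
open import Data.List.Base using (List; []; _∷_; _++_; length; map; foldr; take; drop; reverse; replicate; concatMap; derun; deduplicate; head)
open import Data.List.Membership.Propositional using () renaming (_∈_ to _∈ₗ_)
open import Data.List.Relation.Unary.Linked using (Linked)
open import Data.Maybe.Base using (Maybe)
open import Data.Nat.Base using (ℕ; suc; _+_; _*_; _^_; _≤_; _<_)
open import Data.Nat.Properties using (_≟_)
open import Data.Product.Base using (Σ-syntax; ∃-syntax; _×_)
open import Data.Vec.Base as Vec using (Vec; lookup; _[_]%=_)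
open import Function.Bundles using (_⇔_)
open import Relation.Binary.Bundles using (DecTotalOrder)
open import Relation.Binary.PropositionalEquality.Core using (_≡_; _≢_)

open import Text.Regex (DecTotalOrder.decPoset (≤-decTotalOrder 3)) using (Exp; Range; [_]; ε; singleton; _∈_; _∣_; _∙_; _⋆; _+)

Str : Set
Str = List ℕ

Normalized : Str → Set
Normalized = Linked _≢_

normalize : Str → Str
normalize = derun _≟_

Fully_-ary : ℕ → Str → Set
Fully k -ary s = ∀ x → x ∈ₗ s ⇔ x < k

#symbols : Str → ℕ
#symbols s = length (deduplicate _≟_ s)

flip : ℕ → Str → Str
flip i s = normalize (reverse (take i s) ++ drop i s)

infix 4 _⟶[_]_
infixr 5 _,_∷_

data _⟶[_]_ : Str → List ℕ → Str → Set where
  []    : ∀ {s} → s ⟶[ [] ] s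
  _,_∷_ : ∀ {s i is t} → 1 ≤ i → i ≤ length s →
          flip i s ⟶[ is ] t → s ⟶[ i ∷ is ] t

GroupsTo : ℕ → Str → List ℕ → Set
GroupsTo k s is = ∃[ t ] (s ⟶[ is ] t × length t ≡ k)

-- d is the minimum number of flips turning s into a string of length k.
-- For a normalized fully k-ary s this says d = d_g(s).
IsGroupingDistance : ℕ → Str → ℕ → Set
IsGroupingDistance k s d =
  (∃[ is ] (GroupsTo k s is × length is ≡ d)) ×
  (∀ is → GroupsTo k s is → d ≤ length is)

word : List (Fin 3) → Exp
word = foldr (λ a e → singleton a ∙ e) ε

⟨0⟩ ⟨2⟩ ⟨01⟩ ⟨12⟩ ⟨21⟩ ⟨02⟩ : Exp
⟨0⟩  = singleton 0F
⟨2⟩  = singleton 2F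
⟨01⟩ = [ Range.[ 0F ] ∷ Range.[ 1F ] ∷ [] ]   -- the single symbol {0,1}
⟨12⟩ = word (1F ∷ 2F ∷ [])
⟨21⟩ = word (2F ∷ 1F ∷ [])
⟨02⟩ = word (0F ∷ 2F ∷ [])

typeI typeII typeIII typeIV badType : Exp
typeI   = (⟨0⟩ ∙ ⟨12⟩ ∙ ⟨12⟩ +) ∣ (⟨02⟩ ∙ ⟨12⟩ +)
typeII  = (⟨01⟩ ∙ ⟨2⟩) + ∣ ((⟨2⟩ ∙ ⟨01⟩) + ∙ ⟨2⟩)
typeIII = ⟨0⟩ ∙ ⟨21⟩ + ∙ ⟨02⟩ ∙ ⟨12⟩ ⋆
typeIV  =
    word (2F ∷ 1F ∷ 0F ∷ 2F ∷ 1F ∷ 2F ∷ [])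
  ∣ word (0F ∷ 2F ∷ 1F ∷ 0F ∷ 1F ∷ 2F ∷ [])
  ∣ word (0F ∷ 1F ∷ 2F ∷ 0F ∷ 2F ∷ 1F ∷ 2F ∷ [])
  ∣ word (1F ∷ 2F ∷ 0F ∷ 1F ∷ 2F ∷ 1F ∷ 2F ∷ [])
  ∣ word (0F ∷ 2F ∷ 1F ∷ 0F ∷ 1F ∷ 2F ∷ 1F ∷ 2F ∷ [])
  ∣ word (2F ∷ 0F ∷ 2F ∷ 1F ∷ 0F ∷ 2F ∷ 1F ∷ 2F ∷ [])
  ∣ word (0F ∷ 2F ∷ 0F ∷ 2F ∷ 1F ∷ 0F ∷ 2F ∷ 1F ∷ 2F ∷ [])
  ∣ word (1F ∷ 2F ∷ 0F ∷ 1F ∷ 2F ∷ 0F ∷ 2F ∷ 1F ∷ 2F ∷ [])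
badType = typeI ∣ typeII ∣ typeIII ∣ typeIV

-- Only meaningful for normalized fully ternary s: type II also matches
-- strings that use just two symbols.
Bad : Str → Set
Bad s = Σ[ π ∈ Permutation′ 3 ] ∃[ w ]
  (w ∈ badType × s ≡ map (λ a → toℕ (π ⟨$⟩ʳ a)) w)

-- The machine model is a structured program with a fixed number k of
-- stacks over a fixed finite alphabet Fin g.  Such programs and multi-tape
-- Turing machines simulate each other with constant-factor overhead (a tape
-- is a pair of stacks), so polynomial time here has its usual meaning.

data Program (k g : ℕ) : Set where
  skip  : Program k g
  push  : Fin k → Fin g → Program k g
  -- Remove the top symbol, if any, and branch on it (a finite table, as g is
  -- fixed); nothing signals an empty stack.
  pop   : Fin k → (Maybe (Fin g) → Program k g) → Program k g
  _⨾_   : Program k g → Program k g → Program k g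
  -- Repeat the body as long as the stack is nonempty.
  while : Fin k → Program k g → Program k g

infixr 5 _⨾_

-- The head of each list is the top of that stack.
Stacks : ℕ → ℕ → Set
Stacks k g = Vec (List (Fin g)) k

-- ⟨ P , σ ⟩⇓[ t ] τ : started on σ, P halts on τ after t steps.
infix 4 ⟨_,_⟩⇓[_]_

data ⟨_,_⟩⇓[_]_ {k g} : Program k g → Stacks k g → ℕ → Stacks k g → Set where
  skip : ∀ {σ} → ⟨ skip , σ ⟩⇓[ 1 ] σ
  push : ∀ {σ i a} → ⟨ push i a , σ ⟩⇓[ 1 ] (σ [ i ]%= (a ∷_))
  pop  : ∀ {σ τ i P t} →
         ⟨ P (head (lookup σ i)) , σ [ i ]%= drop 1 ⟩⇓[ t ] τ →
         ⟨ pop i P , σ ⟩⇓[ suc t ] τ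
  seq  : ∀ {σ ρ τ P Q t u} →
         ⟨ P , σ ⟩⇓[ t ] ρ → ⟨ Q , ρ ⟩⇓[ u ] τ →
         ⟨ P ⨾ Q , σ ⟩⇓[ t + u ] τ
  stop : ∀ {σ i P} → lookup σ i ≡ [] →
         ⟨ while i P , σ ⟩⇓[ 1 ] σ
  loop : ∀ {σ ρ τ i P t u} → lookup σ i ≢ [] →
         ⟨ P , σ ⟩⇓[ t ] ρ → ⟨ while i P , ρ ⟩⇓[ u ] τ →
         ⟨ while i P , σ ⟩⇓[ suc (t + u) ] τ

-- The input is placed on stack 0, all other stacks being empty.  The output
-- is the final content of stack 0, a number i being written as i copies of
-- the symbol 1 followed by a 0.
initial : ∀ r e → List (Fin 3) → Stacks (suc r) (3 + e)
initial r e w = map (_↑ˡ e) w Vec.∷ Vec.replicate r []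

encode : ∀ e → List ℕ → List (Fin (3 + e))
encode e = concatMap (λ i → replicate i 1F ++ 0F ∷ [])

-- Some program, in time polynomial in the length of the input w, outputs a
-- list of numbers related to w by R.
PolyTimeComputable : (List (Fin 3) → List ℕ → Set) → Set
PolyTimeComputable R =
  ∃[ r ] ∃[ e ] Σ[ P ∈ Program (suc r) (3 + e) ] ∃[ c ] ∃[ d ]
  ∀ w → ∃[ is ] ∃[ t ] ∃[ τ ]
    ( ⟨ P , initial r e w ⟩⇓[ t ] τ
    × t ≤ c * length w ^ d + c
    × Vec.head τ ≡ encode e is
    × R w is )

-- w need be neither normalized nor use all three symbols.
OptimallyGroups : List (Fin 3) → List ℕ → Set
OptimallyGroups w is =
  GroupsTo (#symbols s) (normalize s) is ×
  IsGroupingDistance (#symbols s) (normalize s) (length is)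
  where
  s : Str
  s = map toℕ w

{-# OPTIONS --safe #-}

-- A flip shortens a string by at most one letter, so grouping needs at least n − 3
-- flips, with equality exactly when all flips can be merging.  Call a flip improving
-- if it merges two letters and does not turn a good string into a bad one, or if it
-- turns a bad string into a good one.  Two facts are needed: no merging flip turns a
-- bad string into a good one, and every string that is not yet grouped has an
-- improving flip.  Coded by differences modulo 3, badness is a regular property and
-- a flip negates and reverses a prefix of the code, so both facts concern a finite
-- automaton that follows a word together with the results of all its flips; they are
-- proved by exploring the reachable states of that automaton, and the
-- correctness of the automaton for badness by exploring its product with the
-- Brzozowski derivatives of the regular expressions.  The algorithm performs
-- improving flips as long as there are any; each is found in one pass over the code.

module Submission where

-- The potential behind the two facts is `value`, the number of differences minus the weight of the
-- kind. The weight is at most 2, and at least 1 on a nonempty word, so a flip that merges nothing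
-- lowers the potential by at most one; for a merging flip this is the first fact. So `value` bounds
-- the distance from below, and improving flips, each lowering it, attain the bound. The obstacle to
-- following all flips with a finite automaton is that a reversed prefix arrives in the wrong order:
-- the letter read last comes first in the mirror image. Hence not a state but the whole transition
-- function of the mirror image is stored, since it can be extended on the left; the sum of the
-- differences modulo 3 settles what happens at the junction. With transition functions of suffixes
-- as well, the stack program evaluates a flip before performing it. These functions serve as
-- symbols of its alphabet, which is why the alphabet has 48 ^ 48 symbols besides the three letters.

open import Defs hiding (_,_∷_)
import Data.Nat.Properties as ℕ
open import Data.Bool.Base using (Bool; true; false; not; _∧_; if_then_else_; T)
open import Data.Bool.ListAction using (any; all)
import Data.Bool.Properties as Bool
open import Data.Fin.Base using (Fin; suc; toℕ; fromℕ<; _↑ˡ_; _↑ʳ_; funToFin; finToFun)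
open import Data.Fin.Patterns using (0F; 1F; 2F; 3F; 4F; 5F; 6F; 7F)
import Data.Fin.Properties as Fin
open import Data.List.Base using (List; []; _∷_; _++_; length; map; foldr; foldl; take; drop; reverse; zipWith; deduplicate; replicate; head; _ʳ++_)
open import Data.List.Membership.Propositional using (_∈_; find)
import Data.List.Membership.Propositional.Properties as ∈
import Data.List.Properties as List
open import Data.List.Relation.Binary.BagAndSetEquality using (∼bag⇒↭)
open import Data.List.Membership.Propositional.Properties.WithK using (unique∧set⇒bag)
open import Data.List.Relation.Binary.Permutation.Propositional as ↭ using (_↭_)
import Data.List.Relation.Binary.Permutation.Propositional.Properties as ↭
open import Data.List.Relation.Unary.All as All using (All; []; _∷_)
import Data.List.Relation.Unary.All.Properties as All
open import Data.List.Relation.Unary.Any as Any using (Any; here; there)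
import Data.List.Relation.Unary.Any.Properties as Any
open import Data.List.Relation.Unary.AllPairs using ([]; _∷_)
open import Data.List.Relation.Unary.Unique.Propositional using (Unique)
import Data.List.Relation.Unary.Unique.Propositional.Properties as Unique
open import Data.List.Relation.Unary.Unique.DecPropositional.Properties ℕ._≟_ using (deduplicate-!)
import Data.List.Membership.DecPropositional as DecMembership
open import Data.List.Relation.Unary.Linked using ([]; [-]; _∷_)
open import Data.Maybe.Base as Maybe using (Maybe; just; nothing; is-just)
open import Data.Nat.Base using (ℕ; zero; suc; _+_; _*_; _^_; _∸_; _≤_; _<_; _≤ᵇ_; _<ᵇ_; _≡ᵇ_; z≤n; s≤s; s≤s⁻¹)
open import Data.Nat.DivMod using (_mod_)
open import Data.Product.Base using (∃-syntax; Σ-syntax; _×_; _,_; proj₁; proj₂)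
open import Data.Product.Properties using (≡-dec)
open import Data.Sum.Base using (_⊎_; inj₁; inj₂)
open import Data.Unit.Base using (tt)
open import Data.Vec.Base as Vec using (Vec; lookup; []; _∷_; _[_]%=_)
import Data.Vec.Properties as Vec
open import Data.Nat.Tactic.RingSolver using (solve-∀)
open import Data.Fin.Permutation using (Permutation′; permutation; _⟨$⟩ʳ_; _⟨$⟩ˡ_; inverseˡ; inverseʳ)
open import Relation.Binary.Bundles using (DecTotalOrder)
import Text.Regex (DecTotalOrder.decPoset (Fin.≤-decTotalOrder 3)) as RE
open RE using (Exp; Range)
open import Text.Regex.Derivative.Brzozowski (DecTotalOrder.decPoset (Fin.≤-decTotalOrder 3)) using (eat; eat-sound; eat-complete)
open import Text.Regex.Properties (DecTotalOrder.decPoset (Fin.≤-decTotalOrder 3)) using ([]∈?_)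
open import Function.Base using (_∘_; id)
open import Function.Bundles using (Equivalence; mk⇔)
open import Relation.Binary.Definitions using (DecidableEquality; WeaklyDecidable)
open import Relation.Binary.PropositionalEquality
open import Relation.Nullary.Decidable.Core using (Dec; does; yes; no; isYes; dec⇒maybe; toWitness; fromWitness; _⊎-dec_)
open import Relation.Nullary.Negation.Core using (¬_; contradiction)

-- Reachable states

module Exploration {S : Set} (_≟_ : WeaklyDecidable (_≡_ {A = S})) (step : S → Bool → S) (P : S → Bool) where

  locate : ∀ s ss → Maybe (s ∈ ss)
  locate s []       = nothing
  locate s (r ∷ ss) with s ≟ r
  ... | just s≡r = just (here s≡r)
  ... | nothing  = Maybe.map there (locate s ss)

  -- The answer `true` requires an empty worklist, so exhausted fuel can only cause a failure, never
  -- a false certificate. Likewise an equality test that misses an equality merely visits a state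
  -- again.
  explore : ℕ → List S → List S → Bool
  explore _       []         seen = true
  explore zero    (_ ∷ _)    seen = false
  explore (suc n) (s ∷ todo) seen =
    if is-just (locate s seen) then explore n todo seen
    else P s ∧ explore n (step s true ∷ step s false ∷ todo) (s ∷ seen)

  Pending : List S → List S → Set
  Pending todo seen =
    ∀ {s} → s ∈ seen → P s ≡ true × ∀ b → step s b ∈ todo ⊎ step s b ∈ seen

  Closed : List S → Set
  Closed R = ∀ {s} → s ∈ R → P s ≡ true × ∀ b → step s b ∈ R

  -- `Pending` is the loop invariant: successors of visited states are visited or queued. Once the
  -- worklist is empty it says that the visited states are closed under `step`.
  explore-closed : ∀ n todo seen → explore n todo seen ≡ true → Pending todo seen →
    ∃[ R ] (Closed R × (∀ {s} → s ∈ todo → s ∈ R) × (∀ {s} → s ∈ seen → s ∈ R))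
  explore-closed _ [] seen _ inv = seen , closed , (λ ()) , (λ s∈ → s∈)
    where
    closed : Closed seen
    closed s∈ = proj₁ (inv s∈) , λ b → case b s∈
      where
      case : ∀ b {s} → s ∈ seen → step s b ∈ seen
      case b s∈ with proj₂ (inv s∈) b
      ... | inj₂ p = p
  explore-closed (suc n) (s ∷ todo) seen eq inv with locate s seen
  ... | just s∈ with explore-closed n todo seen eq inv′
    where
    inv′ : Pending todo seen
    inv′ r∈ = proj₁ (inv r∈) , λ b → settle (proj₂ (inv r∈) b)
      where
      settle : ∀ {r} → r ∈ s ∷ todo ⊎ r ∈ seen → r ∈ todo ⊎ r ∈ seen
      settle (inj₁ (here refl)) = inj₂ s∈
      settle (inj₁ (there r∈))  = inj₁ r∈
      settle (inj₂ r∈)          = inj₂ r∈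
  ...   | R , closed , todo⊆ , seen⊆ =
    R , closed , (λ { (here refl) → seen⊆ s∈ ; (there r∈) → todo⊆ r∈ }) , seen⊆
  explore-closed (suc n) (s ∷ todo) seen eq inv | nothing with P s in Ps
  ... | true with explore-closed n (step s true ∷ step s false ∷ todo) (s ∷ seen) eq inv′
    where
    inv′ : Pending (step s true ∷ step s false ∷ todo) (s ∷ seen)
    inv′ (here refl) = Ps , λ where
      true  → inj₁ (here refl)
      false → inj₁ (there (here refl))
    inv′ (there r∈) = proj₁ (inv r∈) , λ b → settle (proj₂ (inv r∈) b)
      where
      settle : ∀ {r} → r ∈ s ∷ todo ⊎ r ∈ seen →
        r ∈ step s true ∷ step s false ∷ todo ⊎ r ∈ s ∷ seen
      settle (inj₁ (here refl)) = inj₂ (here refl)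
      settle (inj₁ (there r∈))  = inj₁ (there (there r∈))
      settle (inj₂ r∈)          = inj₂ (there r∈)
  ...   | R , closed , todo⊆ , seen⊆ =
    R , closed , (λ { (here refl) → seen⊆ (here refl) ; (there r∈) → todo⊆ (there (there r∈)) })
      , λ r∈ → seen⊆ (there r∈)

  explore-sound : ∀ n starts → explore n starts [] ≡ true →
    ∀ {s} → s ∈ starts → ∀ ds → P (foldl step s ds) ≡ true
  explore-sound n starts eq s∈ ds with explore-closed n starts [] eq (λ ())
  ... | R , closed , starts⊆ , _ = invariant ds (starts⊆ s∈)
    where
    invariant : ∀ ds {s} → s ∈ R → P (foldl step s ds) ≡ true
    invariant []       s∈ = proj₁ (closed s∈)
    invariant (d ∷ ds) s∈ = invariant ds (proj₂ (closed s∈) d)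

-- Words of differences

-- A nonempty normalized string over {0,1,2} is a first letter together with the
-- word of its successive differences modulo 3, true standing for +1 and false for −1.

infixl 6 _▷_

_▷_ : Fin 3 → Bool → Fin 3
0F ▷ true  = 1F
1F ▷ true  = 2F
2F ▷ true  = 0F
0F ▷ false = 2F
1F ▷ false = 0F
2F ▷ false = 1F

end : Fin 3 → List Bool → Fin 3
end = foldl _▷_

letters : Fin 3 → List Bool → List (Fin 3)
letters x []       = x ∷ []
letters x (d ∷ ds) = x ∷ letters (x ▷ d) ds

str : Fin 3 → List Bool → Str
str x ds = map toℕ (letters x ds)

-- The differences contributed where two letters meet: none if they are equal, so inserting `joint`
-- between two words performs the merging of `normalize`.
joint : Fin 3 → Fin 3 → List Bool
joint 0F 0F = []
joint 0F 1F = true ∷ []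
joint 0F 2F = false ∷ []
joint 1F 0F = false ∷ []
joint 1F 1F = []
joint 1F 2F = true ∷ []
joint 2F 0F = true ∷ []
joint 2F 1F = false ∷ []
joint 2F 2F = []

diffs : Fin 3 → List (Fin 3) → List Bool
diffs x []       = []
diffs x (y ∷ ys) = joint x y ++ diffs y ys

reflect : List Bool → List Bool
reflect []       = []
reflect (d ∷ ds) = reflect ds ++ not d ∷ []

-- After the flip the old first letter meets the letter behind `d`. Only their difference matters,
-- so the first letter is taken to be 0, and a merge occurs exactly when `u` together with `d` sums
-- to 0 modulo 3.
flipped : List Bool → Bool → List Bool → List Bool
flipped u d v = reflect u ++ joint 0F (end 0F u ▷ d) ++ v

▷-not : ∀ x d → x ▷ d ▷ not d ≡ x
▷-not 0F true  = refl
▷-not 1F true  = refl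
▷-not 2F true  = refl
▷-not 0F false = refl
▷-not 1F false = refl
▷-not 2F false = refl

▷-comm : ∀ x d e → x ▷ d ▷ e ≡ x ▷ e ▷ d
▷-comm x true  true  = refl
▷-comm x true  false = trans (▷-not x true) (sym (▷-not x false))
▷-comm x false true  = trans (▷-not x false) (sym (▷-not x true))
▷-comm x false false = refl

end-▷ : ∀ x d ds → end (x ▷ d) ds ≡ end x ds ▷ d
end-▷ x d []       = refl
end-▷ x d (e ∷ ds) = trans (cong (λ y → end y ds) (▷-comm x d e)) (end-▷ (x ▷ e) d ds)

joint-▷ : ∀ x y d → joint (x ▷ d) (y ▷ d) ≡ joint x y
joint-▷ x y true  = raise x y
  where
  raise : ∀ x y → joint (x ▷ true) (y ▷ true) ≡ joint x y
  raise 0F 0F = refl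
  raise 0F 1F = refl
  raise 0F 2F = refl
  raise 1F 0F = refl
  raise 1F 1F = refl
  raise 1F 2F = refl
  raise 2F 0F = refl
  raise 2F 1F = refl
  raise 2F 2F = refl
joint-▷ x y false = trans (sym (joint-▷ (x ▷ false) (y ▷ false) true))
  (cong₂ joint (▷-not x false) (▷-not y false))

-- Invariance under translation modulo 3: the junction depends on the sum of the differences and not
-- on the letter they start from.
joint-end : ∀ x ds → joint x (end x ds) ≡ joint 0F (end 0F ds)
joint-end 0F ds = refl
joint-end 1F ds = trans (cong (joint 1F) (end-▷ 0F true ds)) (joint-▷ 0F (end 0F ds) true)
joint-end 2F ds = trans (cong (joint 2F) (end-▷ 0F false ds)) (joint-▷ 0F (end 0F ds) false)

end-∷ʳ : ∀ x ds d → end x (ds ++ d ∷ []) ≡ end x ds ▷ d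
end-∷ʳ x ds d = List.foldl-++ _▷_ x ds (d ∷ [])

end-reflect : ∀ x ds → end (end x ds) (reflect ds) ≡ x
end-reflect x []       = refl
end-reflect x (d ∷ ds) = begin
  end (end (x ▷ d) ds) (reflect ds ++ not d ∷ [])   ≡⟨ end-∷ʳ (end (x ▷ d) ds) (reflect ds) (not d) ⟩
  end (end (x ▷ d) ds) (reflect ds) ▷ not d         ≡⟨ cong (_▷ not d) (end-reflect (x ▷ d) ds) ⟩
  x ▷ d ▷ not d                                     ≡⟨ ▷-not x d ⟩
  x                                                 ∎
  where open ≡-Reasoning

letters-++ : ∀ x u d v → letters x (u ++ d ∷ v) ≡ letters x u ++ letters (end x u ▷ d) v
letters-++ x []      d v = refl
letters-++ x (e ∷ u) d v = cong (x ∷_) (letters-++ (x ▷ e) u d v)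

first∈letters : ∀ x ds → x ∈ letters x ds
first∈letters x []       = here refl
first∈letters x (d ∷ ds) = here refl

length-letters : ∀ x ds → length (letters x ds) ≡ suc (length ds)
length-letters x []       = refl
length-letters x (d ∷ ds) = cong suc (length-letters (x ▷ d) ds)

length-str : ∀ x ds → length (str x ds) ≡ suc (length ds)
length-str x ds = trans (List.length-map toℕ (letters x ds)) (length-letters x ds)

length-reflect : ∀ ds → length (reflect ds) ≡ length ds
length-reflect []       = refl
length-reflect (d ∷ ds) = begin
  length (reflect ds ++ not d ∷ [])   ≡⟨ List.length-++ (reflect ds) ⟩
  length (reflect ds) + 1             ≡⟨ ℕ.+-comm _ 1 ⟩
  suc (length (reflect ds))           ≡⟨ cong suc (length-reflect ds) ⟩
  suc (length ds)                     ∎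
  where open ≡-Reasoning

reverse-letters : ∀ x ds → reverse (letters x ds) ≡ letters (end x ds) (reflect ds)
reverse-letters x []       = refl
reverse-letters x (d ∷ ds) = begin
  reverse (x ∷ letters (x ▷ d) ds)                ≡⟨ List.unfold-reverse x (letters (x ▷ d) ds) ⟩
  reverse (letters (x ▷ d) ds) ++ x ∷ []          ≡⟨ cong₂ (λ l y → l ++ y ∷ []) (reverse-letters (x ▷ d) ds) x≡ ⟩
  letters e (reflect ds) ++ letters (end e (reflect ds) ▷ not d) []
                                                  ≡⟨ letters-++ e (reflect ds) (not d) [] ⟨
  letters e (reflect ds ++ not d ∷ [])            ∎
  where
  open ≡-Reasoning
  e : Fin 3
  e = end (x ▷ d) ds
  x≡ : x ≡ end e (reflect ds) ▷ not d
  x≡ = trans (sym (▷-not x d)) (cong (_▷ not d) (sym (end-reflect (x ▷ d) ds)))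

normalize-∷ : ∀ x y s {ds} → normalize (toℕ y ∷ s) ≡ str y ds →
  normalize (toℕ x ∷ toℕ y ∷ s) ≡ str x (joint x y ++ ds)
normalize-∷ 0F 0F s eq = eq
normalize-∷ 1F 1F s eq = eq
normalize-∷ 2F 2F s eq = eq
normalize-∷ 0F 1F s eq = cong (0 ∷_) eq
normalize-∷ 0F 2F s eq = cong (0 ∷_) eq
normalize-∷ 1F 0F s eq = cong (1 ∷_) eq
normalize-∷ 1F 2F s eq = cong (1 ∷_) eq
normalize-∷ 2F 0F s eq = cong (2 ∷_) eq
normalize-∷ 2F 1F s eq = cong (2 ∷_) eq

normalize-word : ∀ x w → normalize (map toℕ (x ∷ w)) ≡ str x (diffs x w)
normalize-word x []      = refl
normalize-word x (y ∷ w) = normalize-∷ x y (map toℕ w) (normalize-word y w)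

joint-step : ∀ x d → joint x (x ▷ d) ≡ d ∷ []
joint-step 0F true  = refl
joint-step 1F true  = refl
joint-step 2F true  = refl
joint-step 0F false = refl
joint-step 1F false = refl
joint-step 2F false = refl

normalize-∷-str : ∀ x y ds {es} → normalize (str y ds) ≡ str y es →
  normalize (toℕ x ∷ str y ds) ≡ str x (joint x y ++ es)
normalize-∷-str x y []       = normalize-∷ x y []
normalize-∷-str x y (d ∷ ds) = normalize-∷ x y (str (y ▷ d) ds)

normalize-str : ∀ x ds → normalize (str x ds) ≡ str x ds
normalize-str x []       = refl
normalize-str x (d ∷ ds) = trans (normalize-∷-str x (x ▷ d) ds (normalize-str (x ▷ d) ds))
  (cong (λ j → str x (j ++ ds)) (joint-step x d))

normalize-letters : ∀ x u y v →
  normalize (map toℕ (letters x u ++ letters y v)) ≡ str x (u ++ joint (end x u) y ++ v)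
normalize-letters x []      y v = normalize-∷-str x y v (normalize-str y v)
normalize-letters x (d ∷ u) y v = trans (prefix u (normalize-letters (x ▷ d) u y v))
  (cong (λ j → str x (j ++ u ++ joint (end (x ▷ d) u) y ++ v)) (joint-step x d))
  where
  prefix : ∀ u {es} → normalize (map toℕ (letters (x ▷ d) u ++ letters y v)) ≡ str (x ▷ d) es →
    normalize (map toℕ (x ∷ letters (x ▷ d) u ++ letters y v)) ≡ str x (joint x (x ▷ d) ++ es)
  prefix []      = normalize-∷ x (x ▷ d) (str y v)
  prefix (e ∷ u) = normalize-∷ x (x ▷ d) (map toℕ (letters (x ▷ d ▷ e) u ++ letters y v))

take-++ : ∀ {A : Set} (xs ys : List A) → take (length xs) (xs ++ ys) ≡ xs
take-++ []       ys = refl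
take-++ (x ∷ xs) ys = cong (x ∷_) (take-++ xs ys)

drop-++ : ∀ {A : Set} (xs ys : List A) → drop (length xs) (xs ++ ys) ≡ ys
drop-++ []       ys = refl
drop-++ (x ∷ xs) ys = drop-++ xs ys

flip-++ : ∀ (xs ys : List (Fin 3)) →
  flip (length xs) (map toℕ (xs ++ ys)) ≡ normalize (map toℕ (reverse xs ++ ys))
flip-++ xs ys = cong normalize (begin
  reverse (take n (map toℕ zs)) ++ drop n (map toℕ zs)   ≡⟨ cong₂ (λ l r → reverse l ++ r) (List.take-map n zs) (List.drop-map n zs) ⟩
  reverse (map toℕ (take n zs)) ++ map toℕ (drop n zs)   ≡⟨ cong (_++ map toℕ (drop n zs)) (List.reverse-map toℕ (take n zs)) ⟨
  map toℕ (reverse (take n zs)) ++ map toℕ (drop n zs)   ≡⟨ List.map-++ toℕ (reverse (take n zs)) (drop n zs) ⟨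
  map toℕ (reverse (take n zs) ++ drop n zs)             ≡⟨ cong₂ (λ l r → map toℕ (reverse l ++ r)) (take-++ xs ys) (drop-++ xs ys) ⟩
  map toℕ (reverse xs ++ ys)                             ∎)
  where
  open ≡-Reasoning
  n : ℕ
  n = length xs
  zs : List (Fin 3)
  zs = xs ++ ys

-- The differences in `u` span `suc (length u)` letters, so the cut falls on `d`; this difference
-- disappears in favour of the new junction.
flip-str : ∀ x u d v → flip (suc (length u)) (str x (u ++ d ∷ v)) ≡ str (end x u) (flipped u d v)
flip-str x u d v = begin
  flip (suc (length u)) (str x (u ++ d ∷ v))
    ≡⟨ cong₂ (λ n s → flip n (map toℕ s)) (sym (length-letters x u)) (letters-++ x u d v) ⟩
  flip (length (letters x u)) (map toℕ (letters x u ++ letters y v))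
    ≡⟨ flip-++ (letters x u) (letters y v) ⟩
  normalize (map toℕ (reverse (letters x u) ++ letters y v))
    ≡⟨ cong (λ l → normalize (map toℕ (l ++ letters y v))) (reverse-letters x u) ⟩
  normalize (map toℕ (letters (end x u) (reflect u) ++ letters y v))
    ≡⟨ normalize-letters (end x u) (reflect u) y v ⟩
  str (end x u) (reflect u ++ joint (end (end x u) (reflect u)) y ++ v)
    ≡⟨ cong (λ j → str (end x u) (reflect u ++ j ++ v)) joints ⟩
  str (end x u) (flipped u d v) ∎
  where
  open ≡-Reasoning
  y : Fin 3
  y = end x u ▷ d
  joints : joint (end (end x u) (reflect u)) y ≡ joint 0F (end 0F u ▷ d)
  joints = begin
    joint (end (end x u) (reflect u)) y   ≡⟨ cong₂ joint (end-reflect x u) (sym (end-∷ʳ x u d)) ⟩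
    joint x (end x (u ++ d ∷ []))         ≡⟨ joint-end x (u ++ d ∷ []) ⟩
    joint 0F (end 0F (u ++ d ∷ []))       ≡⟨ cong (joint 0F) (end-∷ʳ 0F u d) ⟩
    joint 0F (end 0F u ▷ d)               ∎

flip-all : ∀ x ds → flip (suc (length ds)) (str x ds) ≡ str (end x ds) (reflect ds)
flip-all x ds = begin
  flip (suc (length ds)) (str x ds)
    ≡⟨ cong₂ (λ n s → flip n (map toℕ s)) (sym (length-letters x ds)) (sym (List.++-identityʳ _)) ⟩
  flip (length (letters x ds)) (map toℕ (letters x ds ++ []))
    ≡⟨ flip-++ (letters x ds) [] ⟩
  normalize (map toℕ (reverse (letters x ds) ++ []))
    ≡⟨ cong (normalize ∘ map toℕ) (trans (List.++-identityʳ _) (reverse-letters x ds)) ⟩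
  normalize (str (end x ds) (reflect ds))
    ≡⟨ normalize-str (end x ds) (reflect ds) ⟩
  str (end x ds) (reflect ds) ∎
  where open ≡-Reasoning

length-insert : ∀ (u : List Bool) d v → length (u ++ d ∷ v) ≡ suc (length u + length v)
length-insert u d v = trans (List.length-++ u) (ℕ.+-suc (length u) (length v))

length-flipped : ∀ u d v →
  length (flipped u d v) ≡ length (joint 0F (end 0F u ▷ d)) + (length u + length v)
length-flipped u d v = begin
  length (reflect u ++ j ++ v)             ≡⟨ List.length-++ (reflect u) ⟩
  length (reflect u) + length (j ++ v)     ≡⟨ cong₂ _+_ (length-reflect u) (List.length-++ j) ⟩
  length u + (length j + length v)         ≡⟨ ℕ.+-assoc (length u) _ _ ⟨
  length u + length j + length v           ≡⟨ cong (_+ length v) (ℕ.+-comm (length u) _) ⟩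
  length j + length u + length v           ≡⟨ ℕ.+-assoc (length j) _ _ ⟩
  length j + (length u + length v)         ∎
  where
  open ≡-Reasoning
  j : List Bool
  j = joint 0F (end 0F u ▷ d)

length-joint : ∀ x y → length (joint x y) ≤ 1
length-joint 0F 0F = z≤n
length-joint 0F 1F = s≤s z≤n
length-joint 0F 2F = s≤s z≤n
length-joint 1F 0F = s≤s z≤n
length-joint 1F 1F = z≤n
length-joint 1F 2F = s≤s z≤n
length-joint 2F 0F = s≤s z≤n
length-joint 2F 1F = s≤s z≤n
length-joint 2F 2F = z≤n

length-diffs : ∀ x w → length (diffs x w) ≤ length w
length-diffs x []      = z≤n
length-diffs x (y ∷ w) = ℕ.≤-trans (ℕ.≤-reflexive (List.length-++ (joint x y)))
  (ℕ.+-mono-≤ (length-joint x y) (length-diffs y w))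

length-flipped-≤ : ∀ u d v → length (flipped u d v) ≤ length (u ++ d ∷ v)
length-flipped-≤ u d v = subst₂ _≤_ (sym (length-flipped u d v)) (sym (length-insert u d v))
  (ℕ.+-monoˡ-≤ (length u + length v) (length-joint 0F (end 0F u ▷ d)))

-- Tracking the results of all flips

-- The starting points of the exploration. Shorter words cannot be included, because the grouped
-- ones among them have no improving flip; a word of three differences is never grouped.
triples : List (List Bool)
triples =
    (true  ∷ true ∷ true ∷ []) ∷ (true  ∷ true ∷ false ∷ []) ∷ (true  ∷ false ∷ true ∷ []) ∷ (true  ∷ false ∷ false ∷ [])
  ∷ (false ∷ true ∷ true ∷ []) ∷ (false ∷ true ∷ false ∷ []) ∷ (false ∷ false ∷ true ∷ []) ∷ (false ∷ false ∷ false ∷ [])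
  ∷ []

triple∈triples : ∀ a b c → a ∷ b ∷ c ∷ [] ∈ triples
triple∈triples true  true  true  = here refl
triple∈triples true  true  false = there (here refl)
triple∈triples true  false true  = there (there (here refl))
triple∈triples true  false false = there (there (there (here refl)))
triple∈triples false true  true  = there (there (there (there (here refl))))
triple∈triples false true  false = there (there (there (there (there (here refl)))))
triple∈triples false false true  = there (there (there (there (there (there (here refl))))))
triple∈triples false false false = there (there (there (there (there (there (there (here refl)))))))

∧-true : ∀ {x y} → x ∧ y ≡ true → x ≡ true × y ≡ true
∧-true {true} {true} _ = refl , refl

all-true : ∀ {A : Set} (p : A → Bool) xs → all p xs ≡ true → All (λ x → p x ≡ true) xs
all-true p []       _  = []
all-true p (x ∷ xs) eq = proj₁ (∧-true eq) ∷ all-true p xs (proj₂ (∧-true eq))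

any-true : ∀ {A : Set} (p : A → Bool) xs → any p xs ≡ true → Any (λ x → p x ≡ true) xs
any-true p (x ∷ xs) eq with p x in px
... | true  = here px
... | false = there (any-true p xs eq)

module Automaton {N : ℕ} (δ-row : Bool → Vec (Fin N) N) (q₀ : Fin N) (κ : Fin N → ℕ) where

  State : Set
  State = Fin N

  δ : State → Bool → State
  δ q d = lookup (δ-row d) q

  run : State → List Bool → State
  run = foldl δ

  Class : Set
  Class = Vec State N

  -- A class is the transition function of a word as a table. It grows on the left because appending
  -- a letter to a word prepends the negated letter to its mirror image.
  prepend : Bool → Class → Class
  prepend d c = Vec.map (lookup c) (δ-row d)

  classOf : List Bool → Class
  classOf = foldr prepend (Vec.allFin N)

  run-class : ∀ ds q → lookup (classOf ds) q ≡ run q ds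
  run-class []       q = Vec.lookup-allFin q
  run-class (d ∷ ds) q = trans (Vec.lookup-map q (lookup (classOf ds)) (δ-row d)) (run-class ds (δ q d))

  isZero : Fin 3 → Bool
  isZero 0F = true
  isZero _  = false

  -- Whether a flip merges two letters, and the state of the flipped word.
  Result : Set
  Result = Bool × State

  -- The flip that cuts at the letter just read: from `q₀` through the mirror image by its class,
  -- then across the junction. Later letters are supplied by `continue`.
  candidate : Class → Fin 3 → Result
  candidate c y = isZero y , run (lookup c q₀) (joint 0F y)

  continue : List Bool → Result → Result
  continue v (z , q) = z , run q v

  result : List Bool → Bool → List Bool → Result
  result u d v = isZero (end 0F u ▷ d) , run q₀ (flipped u d v)

  continue-candidate : ∀ u d v →
    continue v (candidate (classOf (reflect u)) (end 0F u ▷ d)) ≡ result u d v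
  continue-candidate u d v = cong (isZero y ,_) (begin
    run (run (lookup (classOf (reflect u)) q₀) (joint 0F y)) v   ≡⟨ cong (λ q → run (run q (joint 0F y)) v) (run-class (reflect u) q₀) ⟩
    run (run (run q₀ (reflect u)) (joint 0F y)) v                ≡⟨ List.foldl-++ δ (run q₀ (reflect u)) (joint 0F y) v ⟨
    run (run q₀ (reflect u)) (joint 0F y ++ v)                   ≡⟨ List.foldl-++ δ q₀ (reflect u) (joint 0F y ++ v) ⟨
    run q₀ (flipped u d v)                                       ∎)
    where
    open ≡-Reasoning
    y : Fin 3
    y = end 0F u ▷ d

  -- In terms of length minus `κ`: a harmless flip lowers it by at most one, an improving flip by at
  -- least one. Without a merge the length stays and `κ` ranges from 1 to 2 on nonempty words, so
  -- harmlessness is automatic.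
  harmless : State → Result → Bool
  harmless q (z , r) = if z then κ r ≤ᵇ κ q else true

  improves : State → Result → Bool
  improves q (z , r) = if z then κ q ≤ᵇ κ r else κ q <ᵇ κ r

  -- Reading a word, the tracker keeps its state and the sum of its letters, the
  -- results of all flips of the part read so far, and the class of the mirror
  -- image of that part.  It has only finitely many reachable values, so that the
  -- effect of all flips on all words can be checked by computation.
  Tracker : Set
  Tracker = State × Fin 3 × List Result × Class

  _≟ʳ_ : DecidableEquality Result
  _≟ʳ_ = ≡-dec Bool._≟_ Fin._≟_

  -- Removing repetitions bounds the list by the 96 possible results; otherwise it would grow with
  -- the word and the exploration would not end.
  collect : List Result → List Result
  collect = deduplicate _≟ʳ_

  collect⁺ : ∀ {r} rs → r ∈ rs → r ∈ collect rs
  collect⁺ rs = ∈.∈-deduplicate⁺ _≟ʳ_ {xs = rs}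

  collect⁻ : ∀ {r} rs → r ∈ collect rs → r ∈ rs
  collect⁻ rs = ∈.∈-deduplicate⁻ _≟ʳ_ rs

  sameTracker : WeaklyDecidable (_≡_ {A = Tracker})
  sameTracker s t = dec⇒maybe (compare s t)
    where
    compare : DecidableEquality Tracker
    compare = ≡-dec Fin._≟_ (≡-dec Fin._≟_ (≡-dec (List.≡-dec _≟ʳ_) (Vec.≡-dec Fin._≟_)))

  results : Tracker → List Result
  results (_ , _ , rs , _) = rs

  track : Tracker → Bool → Tracker
  track (q , y , rs , c) d =
    δ q d , y ▷ d , collect (candidate c (y ▷ d) ∷ map (continue (d ∷ [])) rs) , prepend (not d) c

  start : Tracker
  start = q₀ , 0F , [] , Vec.allFin N

  tracked : List Bool → Tracker
  tracked = foldl track start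

  state-tracked : ∀ T ds → proj₁ (foldl track T ds) ≡ run (proj₁ T) ds
  state-tracked T []       = refl
  state-tracked T (d ∷ ds) = state-tracked (track T d) ds

  sum-tracked : ∀ T ds → proj₁ (proj₂ (foldl track T ds)) ≡ end (proj₁ (proj₂ T)) ds
  sum-tracked T []       = refl
  sum-tracked T (d ∷ ds) = sum-tracked (track T d) ds

  class-tracked : ∀ T w ds → proj₂ (proj₂ (proj₂ T)) ≡ classOf w →
    proj₂ (proj₂ (proj₂ (foldl track T ds))) ≡ classOf (reflect ds ++ w)
  class-tracked T w []       eq = eq
  class-tracked T w (d ∷ ds) eq = trans
    (class-tracked (track T d) (not d ∷ w) ds (cong (prepend (not d)) eq))
    (cong classOf (sym (List.++-assoc (reflect ds) (not d ∷ []) w)))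

  candidate-tracked : ∀ u d v → let (_ , y , _ , c) = tracked u in
    continue v (candidate c (y ▷ d)) ≡ result u d v
  candidate-tracked u d v = trans
    (cong₂ (λ c y → continue v (candidate c (y ▷ d)))
      (trans (class-tracked start [] u refl) (cong classOf (List.++-identityʳ (reflect u))))
      (sum-tracked start u))
    (continue-candidate u d v)

  results-kept : ∀ T v {r} → r ∈ results T → continue v r ∈ results (foldl track T v)
  results-kept T []      r∈ = r∈
  results-kept T (d ∷ v) r∈ = results-kept (track T d) v
    (collect⁺ _ (there (∈.∈-map⁺ (continue (d ∷ [])) r∈)))

  candidate-kept : ∀ (T : Tracker) d → let (_ , y , _ , c) = T in candidate c (y ▷ d) ∈ results (track T d)
  candidate-kept (_ , y , rs , c) d =
    collect⁺ (candidate c (y ▷ d) ∷ map (continue (d ∷ [])) rs) (here refl)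

  results-complete : ∀ u d v → result u d v ∈ results (tracked (u ++ d ∷ v))
  results-complete u d v = subst₂ (λ r T → r ∈ results T)
    (candidate-tracked u d v) (sym (List.foldl-++ track start u (d ∷ v)))
    (results-kept (track (tracked u) d) v (candidate-kept (tracked u) d))

  -- `results-complete` serves the claim about all flips. For the existence claim, a recorded result
  -- must be traced back to an actual flip: it was present after `p`, or was created by a cut inside
  -- `ds`.
  results-sound : ∀ p ds {r} → r ∈ results (foldl track (tracked p) ds) →
    (∃[ r₀ ] (r₀ ∈ results (tracked p) × r ≡ continue ds r₀)) ⊎
    (∃[ u ] ∃[ d ] ∃[ v ] (p ++ ds ≡ u ++ d ∷ v × r ≡ result u d v))
  results-sound p []       r∈ = inj₁ (_ , r∈ , refl)
  results-sound p (d ∷ ds) {r} r∈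
    with results-sound (p ++ d ∷ []) ds (subst (λ T → r ∈ results (foldl track T ds)) (sym (List.foldl-++ track start p (d ∷ []))) r∈)
  ... | inj₂ (u , e , v , eq , r≡) = inj₂ (u , e , v , trans (sym (List.++-assoc p (d ∷ []) ds)) eq , r≡)
  ... | inj₁ (r₁ , r₁∈ , refl)
    with collect⁻ _ (subst (λ T → r₁ ∈ results T) (List.foldl-++ track start p (d ∷ [])) r₁∈)
  ...   | here refl = inj₂ (p , d , ds , refl , candidate-tracked p d ds)
  ...   | there r₁∈′ with ∈.∈-map⁻ (continue (d ∷ [])) r₁∈′
  ...     | r₀ , r₀∈ , refl = inj₁ (r₀ , r₀∈ , refl)

  audit : Tracker → Bool
  audit (q , _ , rs , _) = all (harmless q) rs ∧ any (improves q) rs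

  module Tracking = Exploration sameTracker track audit

  audit-sound : ∀ T → audit T ≡ true →
    All (λ r → harmless (proj₁ T) r ≡ true) (results T) × Any (λ r → improves (proj₁ T) r ≡ true) (results T)
  audit-sound T eq = all-true _ (results T) (proj₁ (∧-true eq)) , any-true _ (results T) (proj₂ (∧-true eq))

  -- A certificate with its fuel hidden in the constructor: the lemmas take an arbitrary one, and
  -- the exploration is computed only where `tracking` builds it. `Counted`, `NonunaryVerified` and
  -- `Matched` follow the same pattern.
  data Verified : Set where
    verified : ∀ {fuel} → Tracking.explore fuel (map tracked triples) [] ≡ true → Verified

  record Audited (w : List Bool) : Set where
    constructor audited
    field ok : audit (tracked w) ≡ true

  audit-tracked : Verified → ∀ a b c ds →
    Audited (a ∷ b ∷ c ∷ ds)
  audit-tracked (verified {fuel} tracking) a b c ds = audited (Tracking.explore-sound fuel (map tracked triples) tracking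
    (∈.∈-map⁺ tracked (triple∈triples a b c)) ds)

  audited-harmless : ∀ w → Audited w →
    ∀ u d v → w ≡ u ++ d ∷ v → harmless (run q₀ w) (result u d v) ≡ true
  audited-harmless _ (audited ok) u d v refl = subst (λ q → harmless q (result u d v) ≡ true)
    (state-tracked start (u ++ d ∷ v))
    (All.lookup (proj₁ (audit-sound (tracked (u ++ d ∷ v)) ok)) (results-complete u d v))

  audited-improves : ∀ w → Audited w →
    ∃[ u ] ∃[ d ] ∃[ v ] (w ≡ u ++ d ∷ v × improves (run q₀ w) (result u d v) ≡ true)
  audited-improves w (audited ok) with find (proj₂ (audit-sound (tracked w) ok))
  ... | r , r∈ , better with results-sound [] w r∈
  ...   | inj₂ (u , d , v , eq , refl) = u , d , v , eq ,
    subst (λ q → improves q (result u d v) ≡ true) (state-tracked start w) better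

-- The automaton for badness

data Kind : Set where
  unary binary bad good : Kind

-- The minimal automaton reading a difference word and telling apart the strings
-- with one symbol, with two symbols, the bad ones and the good ones.
-- It was found by computer; `#symbols-str`, `kind-bad` and `kind-good` certify it.

δ-row : Bool → Vec (Fin 48) 48
δ-row true = Vec.map (_mod 48)
  ( 1 ∷ 3 ∷ 5 ∷ 7 ∷ 9 ∷ 11 ∷ 13 ∷ 15 ∷ 17 ∷ 11 ∷ 20 ∷ 22 ∷ 23 ∷ 24 ∷ 26 ∷ 28
  ∷ 30 ∷ 32 ∷ 20 ∷ 23 ∷ 24 ∷ 30 ∷ 34 ∷ 24 ∷ 30 ∷ 13 ∷ 36 ∷ 37 ∷ 30 ∷ 40 ∷ 30 ∷ 37
  ∷ 41 ∷ 30 ∷ 43 ∷ 30 ∷ 30 ∷ 30 ∷ 45 ∷ 46 ∷ 30 ∷ 46 ∷ 40 ∷ 30 ∷ 30 ∷ 43 ∷ 30 ∷ 44 ∷ [] )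
δ-row false = Vec.map (_mod 48)
  ( 2 ∷ 4 ∷ 6 ∷ 8 ∷ 10 ∷ 12 ∷ 14 ∷ 16 ∷ 18 ∷ 19 ∷ 21 ∷ 20 ∷ 10 ∷ 25 ∷ 27 ∷ 29
  ∷ 31 ∷ 8 ∷ 30 ∷ 18 ∷ 18 ∷ 33 ∷ 30 ∷ 19 ∷ 20 ∷ 35 ∷ 30 ∷ 38 ∷ 39 ∷ 30 ∷ 30 ∷ 30
  ∷ 30 ∷ 42 ∷ 30 ∷ 44 ∷ 29 ∷ 40 ∷ 30 ∷ 42 ∷ 30 ∷ 30 ∷ 30 ∷ 40 ∷ 47 ∷ 47 ∷ 41 ∷ 30 ∷ [] )

kinds : Vec Kind 48
kinds = u ∷ a ∷ a ∷ g ∷ a ∷ a ∷ g ∷ g ∷ b ∷ a ∷ g ∷ g ∷ a ∷ b ∷ g ∷ b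
      ∷ g ∷ b ∷ g ∷ a ∷ b ∷ g ∷ g ∷ a ∷ g ∷ b ∷ g ∷ b ∷ g ∷ b ∷ g ∷ b
      ∷ g ∷ g ∷ g ∷ g ∷ b ∷ b ∷ g ∷ b ∷ b ∷ b ∷ g ∷ g ∷ b ∷ b ∷ g ∷ g ∷ []
  where
  u a b g : Kind
  u = unary
  a = binary
  b = bad
  g = good

q₀ : Fin 48
q₀ = 0F

kind : Fin 48 → Kind
kind = lookup kinds

-- A string of length n has n − 1 differences; its distance is n − 1 − weight.
weight : Kind → ℕ
weight unary  = 0
weight binary = 1
weight bad    = 1
weight good   = 2

weight≤2 : ∀ k → weight k ≤ 2
weight≤2 unary  = z≤n
weight≤2 binary = s≤s z≤n
weight≤2 bad    = s≤s z≤n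
weight≤2 good   = s≤s (s≤s z≤n)

κ : Fin 48 → ℕ
κ = weight ∘ kind

κ≤2 : ∀ q → κ q ≤ 2
κ≤2 = weight≤2 ∘ kind

open Automaton δ-row q₀ κ

tracking : Verified
tracking = verified {1000} refl

audit-long : ∀ a b c ds → Audited (a ∷ b ∷ c ∷ ds)
audit-long = audit-tracked tracking

-- Words of at most two differences lie outside the exploration and are evaluated; the remaining
-- cases only expose the first three differences.
flip-harmless : ∀ u d v → harmless (run q₀ (u ++ d ∷ v)) (result u d v) ≡ true
flip-harmless []              true  []           = refl
flip-harmless []              false []           = refl
flip-harmless []              true  (e ∷ [])     = refl
flip-harmless []              false (e ∷ [])     = refl
flip-harmless []              d     (e ∷ f ∷ v)  = audited-harmless _ (audit-long d e f v) [] d _ refl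
flip-harmless (true  ∷ [])    true  []           = refl
flip-harmless (true  ∷ [])    false []           = refl
flip-harmless (false ∷ [])    true  []           = refl
flip-harmless (false ∷ [])    false []           = refl
flip-harmless (a ∷ [])        d     (e ∷ v)      = audited-harmless _ (audit-long a d e v) (a ∷ []) d _ refl
flip-harmless (a ∷ b ∷ [])    d     v            = audited-harmless _ (audit-long a b d v) (a ∷ b ∷ []) d v refl
flip-harmless (a ∷ b ∷ c ∷ u) d     v            = audited-harmless _ (audit-long a b c (u ++ d ∷ v)) (a ∷ b ∷ c ∷ u) d v refl

flip-improves : ∀ ds → κ (run q₀ ds) < length ds →
  ∃[ u ] ∃[ d ] ∃[ v ] (ds ≡ u ++ d ∷ v × improves (run q₀ ds) (result u d v) ≡ true)
flip-improves (true  ∷ [])         (s≤s ())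
flip-improves (false ∷ [])         (s≤s ())
flip-improves (true  ∷ true  ∷ []) (s≤s (s≤s ()))
-- The string has the form `xyx`; reversing its first two letters brings the two copies of `x`
-- together.
flip-improves (true  ∷ false ∷ []) _ = true ∷ [] , false , [] , refl , refl
flip-improves (false ∷ true  ∷ []) _ = false ∷ [] , true , [] , refl , refl
flip-improves (false ∷ false ∷ []) (s≤s (s≤s ()))
flip-improves (a ∷ b ∷ c ∷ ds)     _ = audited-improves (a ∷ b ∷ c ∷ ds) (audit-long a b c ds)

-- The number of symbols

same-length : ∀ {A : Set} {xs ys : List A} → Unique xs → Unique ys →
  (∀ {x} → x ∈ xs → x ∈ ys) → (∀ {x} → x ∈ ys → x ∈ xs) → length xs ≡ length ys
same-length !xs !ys xs⊆ys ys⊆xs = ↭.↭-length (∼bag⇒↭ (unique∧set⇒bag !xs !ys (mk⇔ xs⊆ys ys⊆xs)))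

infix 4 _≐_
_≐_ : Str → Str → Set
s ≐ t = (∀ {x} → x ∈ s → x ∈ t) × (∀ {x} → x ∈ t → x ∈ s)

≐-trans : ∀ {r s t} → r ≐ s → s ≐ t → r ≐ t
≐-trans (r⊆s , s⊆r) (s⊆t , t⊆s) = s⊆t ∘ r⊆s , s⊆r ∘ t⊆s

#symbols-unique : ∀ {s t} → Unique t → s ≐ t → #symbols s ≡ length t
#symbols-unique {s} !t (s⊆t , t⊆s) = same-length (deduplicate-! s) !t
  (s⊆t ∘ ∈.∈-deduplicate⁻ ℕ._≟_ s) (∈.∈-deduplicate⁺ ℕ._≟_ ∘ t⊆s)

#symbols-cong : ∀ {s t} → s ≐ t → #symbols s ≡ #symbols t
#symbols-cong {s} {t} s≐t = #symbols-unique (deduplicate-! t)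
  (≐-trans s≐t (∈.∈-deduplicate⁺ ℕ._≟_ , ∈.∈-deduplicate⁻ ℕ._≟_ t))

normalize-≐ : ∀ s → normalize s ≐ s
normalize-≐ s = ∈.∈-derun⁻ ℕ._≟_ s , ∈.∈-derun⁺ ℕ._≟_

flip-≐ : ∀ i s → flip i s ≐ s
flip-≐ i s = ≐-trans (normalize-≐ _) (↭.∈-resp-↭ perm , ↭.∈-resp-↭ (↭.↭-sym perm))
  where
  perm : reverse (take i s) ++ drop i s ↭ s
  perm = ↭.↭-trans (↭.++⁺ʳ (drop i s) (↭.↭-reverse (take i s))) (↭.↭-reflexive (List.take++drop≡id i s))

#symbols-flip : ∀ i s → #symbols (flip i s) ≡ #symbols s
#symbols-flip i s = #symbols-cong (flip-≐ i s)

#symbols≤length : ∀ s → #symbols s ≤ length s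
#symbols≤length = List.length-deduplicate ℕ._≟_

-- The number of differences of a grouped string with the same symbols. It exceeds `weight` exactly
-- for bad strings, which accounts for their extra flip.
rank : Kind → ℕ
rank unary  = 0
rank binary = 1
rank bad    = 2
rank good   = 2

open DecMembership (Fin._≟_ {3}) using (_∈?_)

-- The symbols met so far, besides the last letter and the state.
Census : Set
Census = Fin 3 × List (Fin 3) × State

note : Fin 3 → List (Fin 3) → List (Fin 3)
note x xs = if does (x ∈? xs) then xs else x ∷ xs

∈-note : ∀ x xs {y} → y ∈ x ∷ xs → y ∈ note x xs
∈-note x xs y∈ with x ∈? xs | y∈
... | yes x∈ | here refl = x∈
... | yes _  | there y∈′ = y∈′
... | no  _  | y∈′       = y∈′

note-∈ : ∀ x xs {y} → y ∈ note x xs → y ∈ x ∷ xs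
note-∈ x xs y∈ with x ∈? xs
... | yes _ = there y∈
... | no  _ = y∈

note-! : ∀ x xs → Unique xs → Unique (note x xs)
note-! x xs !xs with x ∈? xs
... | yes _  = !xs
... | no  x∉ = All.¬Any⇒All¬ xs x∉ ∷ !xs

count : Census → Bool → Census
count (x , xs , q) d = x ▷ d , note (x ▷ d) xs , δ q d

counted : Census → List Bool → Census
counted = foldl count

state-counted : ∀ x xs q ds → proj₂ (proj₂ (counted (x , xs , q) ds)) ≡ run q ds
state-counted x xs q []       = refl
state-counted x xs q (d ∷ ds) = state-counted (x ▷ d) (note (x ▷ d) xs) (δ q d) ds

counted-! : ∀ x xs q ds → Unique xs → Unique (proj₁ (proj₂ (counted (x , xs , q) ds)))
counted-! x xs q []       !xs = !xs
counted-! x xs q (d ∷ ds) !xs = counted-! (x ▷ d) (note (x ▷ d) xs) (δ q d) ds (note-! (x ▷ d) xs !xs)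

-- The premise `x ∈ xs` is the invariant that the current letter is already noted, as `count` notes
-- each letter on arrival.
∈-counted : ∀ x xs q ds {y} → y ∈ xs ⊎ y ∈ letters x ds → x ∈ xs →
  y ∈ proj₁ (proj₂ (counted (x , xs , q) ds))
∈-counted x xs q []       (inj₁ y∈)          x∈ = y∈
∈-counted x xs q []       (inj₂ (here refl)) x∈ = x∈
∈-counted x xs q (d ∷ ds) y∈                 x∈ =
  ∈-counted (x ▷ d) (note (x ▷ d) xs) (δ q d) ds (later y∈) (∈-note (x ▷ d) xs (here refl))
  where
  later : ∀ {y} → y ∈ xs ⊎ y ∈ letters x (d ∷ ds) → y ∈ note (x ▷ d) xs ⊎ y ∈ letters (x ▷ d) ds
  later (inj₁ y∈)          = inj₁ (∈-note (x ▷ d) xs (there y∈))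
  later (inj₂ (here refl)) = inj₁ (∈-note (x ▷ d) xs (there x∈))
  later (inj₂ (there y∈))  = inj₂ y∈

counted-∈ : ∀ x xs q ds {y} → y ∈ proj₁ (proj₂ (counted (x , xs , q) ds)) →
  y ∈ xs ⊎ y ∈ letters x ds
counted-∈ x xs q []       y∈ = inj₁ y∈
counted-∈ x xs q (d ∷ ds) y∈ with counted-∈ (x ▷ d) (note (x ▷ d) xs) (δ q d) ds y∈
... | inj₂ y∈′ = inj₂ (there y∈′)
... | inj₁ y∈′ with note-∈ (x ▷ d) xs y∈′
...   | here refl = inj₂ (there (first∈letters (x ▷ d) ds))
...   | there y∈″ = inj₁ y∈″

sameCensus : WeaklyDecidable (_≡_ {A = Census})
sameCensus s t = dec⇒maybe (compare s t)
  where
  compare : DecidableEquality Census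
  compare = ≡-dec Fin._≟_ (≡-dec (List.≡-dec Fin._≟_) Fin._≟_)

tally : Census → Bool
tally (_ , xs , q) = length xs ≡ᵇ suc (rank (kind q))

census : Fin 3 → Census
census x = x , x ∷ [] , q₀

module Counting = Exploration sameCensus count tally

data Counted : Set where
  counting : ∀ {fuel} → Counting.explore fuel (map census (0F ∷ 1F ∷ 2F ∷ [])) [] ≡ true → Counted

all-counted : Counted
all-counted = counting {2000} refl

tallied : Counted → ∀ x ds → tally (counted (census x) ds) ≡ true
tallied (counting {fuel} eq) x ds = Counting.explore-sound fuel (map census (0F ∷ 1F ∷ 2F ∷ [])) eq (start∈ x) ds
  where
  start∈ : ∀ x → census x ∈ map census (0F ∷ 1F ∷ 2F ∷ [])
  start∈ 0F = here refl
  start∈ 1F = there (here refl)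
  start∈ 2F = there (there (here refl))

#symbols-str : ∀ x ds → #symbols (str x ds) ≡ suc (rank (kind (run q₀ ds)))
#symbols-str x ds = trans
  (#symbols-unique {t = map toℕ xs}
    (Unique.map⁺ Fin.toℕ-injective (counted-! x (x ∷ []) q₀ ds ([] ∷ []))) (str⊆ , ⊆str))
  (trans (List.length-map toℕ xs)
    (trans (ℕ.≡ᵇ⇒≡ _ _ (subst T (sym (tallied all-counted x ds)) tt))
      (cong (suc ∘ rank ∘ kind) (state-counted x (x ∷ []) q₀ ds))))
  where
  xs : List (Fin 3)
  xs = proj₁ (proj₂ (counted (census x) ds))
  str⊆ : ∀ {y} → y ∈ str x ds → y ∈ map toℕ xs
  str⊆ y∈ with ∈.∈-map⁻ toℕ y∈
  ... | z , z∈ , refl = ∈.∈-map⁺ toℕ (∈-counted x (x ∷ []) q₀ ds (inj₂ z∈) (here refl))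
  ⊆str : ∀ {y} → y ∈ map toℕ xs → y ∈ str x ds
  ⊆str y∈ with ∈.∈-map⁻ toℕ y∈
  ... | z , z∈ , refl with counted-∈ x (x ∷ []) q₀ ds z∈
  ...   | inj₂ z∈′         = ∈.∈-map⁺ toℕ z∈′
  ...   | inj₁ (here refl) = ∈.∈-map⁺ toℕ (first∈letters x ds)

-- Grouping distance

module Nonunary = Exploration (λ p q → dec⇒maybe (p Fin.≟ q)) δ (λ q → 1 ≤ᵇ κ q)

data NonunaryVerified : Set where
  verified : ∀ {fuel} → Nonunary.explore fuel (map (δ q₀) (true ∷ false ∷ [])) [] ≡ true → NonunaryVerified

nonunary-verified : NonunaryVerified
nonunary-verified = verified {200} refl

κ-positive : ∀ d ds → 1 ≤ κ (run q₀ (d ∷ ds))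
κ-positive = go nonunary-verified
  where
  start∈ : ∀ d → δ q₀ d ∈ map (δ q₀) (true ∷ false ∷ [])
  start∈ true  = here refl
  start∈ false = there (here refl)
  go : NonunaryVerified → ∀ d ds → 1 ≤ κ (run q₀ (d ∷ ds))
  go (verified {fuel} eq) d ds = ℕ.≤ᵇ⇒≤ 1 _ (subst T (sym
    (Nonunary.explore-sound fuel (map (δ q₀) (true ∷ false ∷ [])) eq (start∈ d) ds)) tt)

κ≤length : ∀ ds → κ (run q₀ ds) ≤ length ds
κ≤length []           = z≤n
κ≤length (true ∷ [])  = s≤s z≤n
κ≤length (false ∷ []) = s≤s z≤n
κ≤length (d ∷ e ∷ ds) = ℕ.≤-trans (κ≤2 (run q₀ (d ∷ e ∷ ds))) (s≤s (s≤s z≤n))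

value : List Bool → ℕ
value ds = length ds ∸ κ (run q₀ ds)

≤ᵇ-true : ∀ {m n} → (m ≤ᵇ n) ≡ true → m ≤ n
≤ᵇ-true {m} {n} eq = ℕ.≤ᵇ⇒≤ m n (subst T (sym eq) tt)

suc-∸-≤ : ∀ m n → suc m ∸ n ≤ suc (m ∸ n)
suc-∸-≤ m       zero    = ℕ.≤-refl
suc-∸-≤ zero    (suc n) = ℕ.≤-trans (ℕ.m∸n≤m 0 n) z≤n
suc-∸-≤ (suc m) (suc n) = suc-∸-≤ m n

-- Here `n` stands for the differences outside the cut, so the word has `suc n` of them, and `y`
-- tells whether the flip merges.
harmless⇒≤ : ∀ y q r n → harmless q (isZero y , r) ≡ true → 1 ≤ κ q →
  suc n ∸ κ q ≤ suc (length (joint 0F y) + n ∸ κ r)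
harmless⇒≤ 0F q r n h _ =
  ℕ.≤-trans (ℕ.∸-monoʳ-≤ (suc n) (≤ᵇ-true {κ r} {κ q} h)) (suc-∸-≤ n (κ r))
harmless⇒≤ 1F q r n _ 1≤κ = begin
  suc n ∸ κ q         ≤⟨ ℕ.∸-monoʳ-≤ (suc n) 1≤κ ⟩
  n                   ≤⟨ suc-∸-≤ n 1 ⟩
  -- By computation `n ∸ 1` is `suc n ∸ 2`, and 2 bounds every weight.
  suc (n ∸ 1)         ≤⟨ s≤s (ℕ.∸-monoʳ-≤ (suc n) (κ≤2 r)) ⟩
  suc (suc n ∸ κ r)   ∎
  where open ℕ.≤-Reasoning
harmless⇒≤ 2F q r n h 1≤κ = harmless⇒≤ 1F q r n refl 1≤κ

-- The bound on `κ r` makes the truncated subtraction exact, so that a successor can be moved across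
-- it.
improves⇒< : ∀ y q r n → improves q (isZero y , r) ≡ true → κ r ≤ length (joint 0F y) + n →
  length (joint 0F y) + n ∸ κ r < suc n ∸ κ q
improves⇒< 0F q r n h κ≤ = ℕ.≤-trans
  (ℕ.≤-reflexive (sym (ℕ.+-∸-assoc 1 κ≤))) (ℕ.∸-monoʳ-≤ (suc n) (≤ᵇ-true {κ q} {κ r} h))
improves⇒< 1F q r n h κ≤ = ℕ.≤-trans
  (ℕ.≤-reflexive (sym (ℕ.+-∸-assoc 1 κ≤))) (ℕ.∸-monoʳ-≤ (suc (suc n)) (≤ᵇ-true {suc (κ q)} {κ r} h))
improves⇒< 2F q r n h κ≤ = improves⇒< 1F q r n h κ≤

value-flipped : ∀ u d v → value (u ++ d ∷ v) ≤ suc (value (flipped u d v))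
value-flipped u d v = subst₂ (λ m n → m ∸ κ (run q₀ (u ++ d ∷ v)) ≤ suc (n ∸ κ (run q₀ (flipped u d v))))
  (sym (length-insert u d v)) (sym (length-flipped u d v))
  (harmless⇒≤ (end 0F u ▷ d) (run q₀ (u ++ d ∷ v)) (run q₀ (flipped u d v)) (length u + length v) (flip-harmless u d v) (positive u))
  where
  positive : ∀ u → 1 ≤ κ (run q₀ (u ++ d ∷ v))
  positive []      = κ-positive d v
  positive (e ∷ u) = κ-positive e (u ++ d ∷ v)

value-improves : ∀ u d v → improves (run q₀ (u ++ d ∷ v)) (result u d v) ≡ true →
  value (flipped u d v) < value (u ++ d ∷ v)
value-improves u d v better = subst₂ (λ m n → n ∸ κ (run q₀ (flipped u d v)) < m ∸ κ (run q₀ (u ++ d ∷ v)))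
  (sym (length-insert u d v)) (sym (length-flipped u d v))
  (improves⇒< (end 0F u ▷ d) (run q₀ (u ++ d ∷ v)) (run q₀ (flipped u d v)) (length u + length v) better
    (subst (κ (run q₀ (flipped u d v)) ≤_) (length-flipped u d v) (κ≤length (flipped u d v))))

value-reflect : ∀ ds → value ds ≤ suc (value (reflect ds))
value-reflect []       = z≤n
value-reflect (d ∷ ds) = subst (λ n → value (d ∷ ds) ≤ suc (n ∸ κ (run q₀ (reflect (d ∷ ds)))))
  (sym (length-reflect (d ∷ ds)))
  -- Reversing the whole string merges nothing, so it is treated like a flip with the nonzero
  -- junction `1F`.
  (harmless⇒≤ 1F (run q₀ (d ∷ ds)) (run q₀ (reflect (d ∷ ds))) (length ds) refl (κ-positive d ds))

data Improving (ds : List Bool) : List ℕ → Set where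
  done : value ds ≡ 0 → Improving ds []
  step : ∀ u d v {is} → ds ≡ u ++ d ∷ v → improves (run q₀ ds) (result u d v) ≡ true →
    Improving (flipped u d v) is → Improving ds (suc (length u) ∷ is)

improving-≤ : ∀ {ds is} → Improving ds is → length is ≤ value ds
improving-≤ (done _) = z≤n
improving-≤ (step u d v refl better rest) =
  ℕ.≤-trans (s≤s (improving-≤ rest)) (value-improves u d v better)

improving-exists : ∀ n ds → value ds ≤ n → ∃[ is ] (Improving ds is)
improving-exists n ds v≤ with value ds in eq
... | zero = [] , done eq
improving-exists (suc n) ds (s≤s v≤) | suc w
  with flip-improves ds (ℕ.m∸n≢0⇒n<m (λ v≡0 → ℕ.1+n≢0 (trans (sym eq) v≡0)))
... | u , d , v , refl , better
  with improving-exists n (flipped u d v)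
    (ℕ.≤-trans (s≤s⁻¹ (subst (value (flipped u d v) <_) eq (value-improves u d v better))) v≤)
...   | is , rest = suc (length u) ∷ is , step u d v refl better rest

weight≤rank : ∀ k → weight k ≤ rank k
weight≤rank unary  = z≤n
weight≤rank binary = s≤s z≤n
weight≤rank bad    = s≤s z≤n
weight≤rank good   = s≤s (s≤s z≤n)

rank≤2 : ∀ k → rank k ≤ 2
rank≤2 unary  = z≤n
rank≤2 binary = s≤s z≤n
rank≤2 bad    = s≤s (s≤s z≤n)
rank≤2 good   = s≤s (s≤s z≤n)

value≡0⇒grouped : ∀ x ds → value ds ≡ 0 → length (str x ds) ≡ #symbols (str x ds)
value≡0⇒grouped x ds v≡0 = ℕ.≤-antisym
  (begin
    length (str x ds)                ≡⟨ length-str x ds ⟩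
    suc (length ds)                  ≤⟨ s≤s (ℕ.m∸n≡0⇒m≤n v≡0) ⟩
    suc (κ (run q₀ ds))              ≤⟨ s≤s (weight≤rank (kind (run q₀ ds))) ⟩
    suc (rank (kind (run q₀ ds)))    ≡⟨ #symbols-str x ds ⟨
    #symbols (str x ds)              ∎)
  (#symbols≤length (str x ds))
  where open ℕ.≤-Reasoning

-- As `rank` exceeds `weight` on bad strings, bounds alone do not suffice: a grouped string has at
-- most two differences, and no string that short is bad.
grouped⇒value≡0 : ∀ x ds → length (str x ds) ≡ #symbols (str x ds) → value ds ≡ 0
grouped⇒value≡0 x ds eq = short ds (ℕ.suc-injective
  (trans (sym (length-str x ds)) (trans eq (#symbols-str x ds))))
  where
  short : ∀ ds → length ds ≡ rank (kind (run q₀ ds)) → value ds ≡ 0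
  short []                   _  = refl
  short (true  ∷ [])         _  = refl
  short (false ∷ [])         _  = refl
  short (true  ∷ true  ∷ []) _  = refl
  short (true  ∷ false ∷ []) ()
  short (false ∷ true  ∷ []) ()
  short (false ∷ false ∷ []) _  = refl
  short (d ∷ e ∷ f ∷ ds)     eq with subst (_≤ 2) (sym eq) (rank≤2 (kind (run q₀ (d ∷ e ∷ f ∷ ds))))
  ... | s≤s (s≤s ())

split : ∀ n (ds : List Bool) → n ≤ length ds →
  n ≡ length ds ⊎ ∃[ u ] ∃[ d ] ∃[ v ] (ds ≡ u ++ d ∷ v × n ≡ length u)
split zero    []       _        = inj₁ refl
split zero    (d ∷ ds) _        = inj₂ ([] , d , ds , refl , refl)
split (suc n) (d ∷ ds) (s≤s n≤) with split n ds n≤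
... | inj₁ eq                       = inj₁ (cong suc eq)
... | inj₂ (u , e , v , refl , eq) = inj₂ (d ∷ u , e , v , refl , cong suc eq)

improving-groups : ∀ {ds is} → Improving ds is → ∀ x →
  GroupsTo (#symbols (str x ds)) (str x ds) is
improving-groups {ds} (done v≡0) x = str x ds , [] , value≡0⇒grouped x ds v≡0
improving-groups (step u d v refl better rest) x with improving-groups rest (end x u)
... | t , path , eq =
  t , Defs._,_∷_ (s≤s z≤n) i≤ (subst (_⟶[ _ ] t) (sym (flip-str x u d v)) path) ,
  trans eq (trans (cong #symbols (sym (flip-str x u d v))) (#symbols-flip (suc (length u)) (str x (u ++ d ∷ v))))
  where
  i≤ : suc (length u) ≤ length (str x (u ++ d ∷ v))
  i≤ = begin
    suc (length u)                    ≤⟨ s≤s (ℕ.m≤m+n (length u) (length v)) ⟩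
    suc (length u + length v)         ≡⟨ length-insert u d v ⟨
    length (u ++ d ∷ v)               ≤⟨ ℕ.n≤1+n _ ⟩
    suc (length (u ++ d ∷ v))         ≡⟨ length-str x (u ++ d ∷ v) ⟨
    length (str x (u ++ d ∷ v))       ∎
    where open ℕ.≤-Reasoning

-- The lower bound for every flip sequence: each flip lowers `value` by at most one, and it is 0 at
-- the end. The equations for `s` and `k` let the induction pass to a flipped string, which has the
-- form `str` only up to a proof and keeps its symbols.
groups⇒value≤ : ∀ {k s} is x ds → s ≡ str x ds → k ≡ #symbols s → GroupsTo k s is → value ds ≤ length is
groups⇒value≤ [] x ds refl refl (_ , [] , eq) = ℕ.≤-reflexive (grouped⇒value≡0 x ds eq)
groups⇒value≤ (suc n ∷ is) x ds refl refl (t , Defs._,_∷_ _ i≤ path , eq)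
  with split n ds (s≤s⁻¹ (subst (suc n ≤_) (length-str x ds) i≤))
... | inj₁ refl = ℕ.≤-trans (value-reflect ds) (s≤s
  (groups⇒value≤ is (end x ds) (reflect ds) (flip-all x ds)
    (sym (#symbols-flip (suc n) (str x ds))) (t , path , eq)))
... | inj₂ (u , d , v , refl , refl) = ℕ.≤-trans (value-flipped u d v) (s≤s
  (groups⇒value≤ is (end x u) (flipped u d v) (flip-str x u d v)
    (sym (#symbols-flip (suc n) (str x ds))) (t , path , eq)))

-- The greedy choice is optimal: any sequence of improving flips that ends at value 0 meets the
-- lower bound, whichever flips were taken.
improving-length : ∀ {ds is} → Improving ds is → length is ≡ value ds
improving-length {ds} {is} imp = ℕ.≤-antisym (improving-≤ imp)
  (groups⇒value≤ is 0F ds refl refl (improving-groups imp 0F))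

value-distance : ∀ x ds → IsGroupingDistance (#symbols (str x ds)) (str x ds) (value ds)
value-distance x ds with improving-exists (value ds) ds ℕ.≤-refl
... | is , imp = (is , improving-groups imp x , improving-length imp) ,
  λ is′ → groups⇒value≤ is′ x ds refl refl

-- Badness as a regular expression

sameRange : WeaklyDecidable (_≡_ {A = Range})
sameRange Range.[ a ]     Range.[ b ]     = Maybe.map (cong Range.[_]) (dec⇒maybe (a Fin.≟ b))
sameRange (a Range.─ b)   (c Range.─ d)   =
  Maybe.zipWith (cong₂ Range._─_) (dec⇒maybe (a Fin.≟ c)) (dec⇒maybe (b Fin.≟ d))
sameRange _               _               = nothing

sameList : ∀ {A : Set} → WeaklyDecidable (_≡_ {A = A}) → WeaklyDecidable (_≡_ {A = List A})
sameList same []       []       = just refl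
sameList same (x ∷ xs) (y ∷ ys) = Maybe.zipWith (cong₂ _∷_) (same x y) (sameList same xs ys)
sameList same _        _        = nothing

sameExp : WeaklyDecidable (_≡_ {A = Exp})
sameExp Exp.ε         Exp.ε         = just refl
sameExp Exp.[ r ]     Exp.[ s ]     = Maybe.map (cong Exp.[_]) (sameList sameRange r s)
sameExp Exp.[^ r ]    Exp.[^ s ]    = Maybe.map (cong Exp.[^_]) (sameList sameRange r s)
sameExp (e Exp.∣ f)   (g Exp.∣ h)   = Maybe.zipWith (cong₂ Exp._∣_) (sameExp e g) (sameExp f h)
sameExp (e Exp.∙ f)   (g Exp.∙ h)   = Maybe.zipWith (cong₂ Exp._∙_) (sameExp e g) (sameExp f h)
sameExp (e Exp.⋆)     (f Exp.⋆)     = Maybe.map (cong Exp._⋆) (sameExp e f)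
sameExp _             _             = nothing

relabellings : List (Vec (Fin 3) 3)
relabellings =
    (0F ∷ 1F ∷ 2F ∷ []) ∷ (0F ∷ 2F ∷ 1F ∷ []) ∷ (1F ∷ 0F ∷ 2F ∷ [])
  ∷ (1F ∷ 2F ∷ 0F ∷ []) ∷ (2F ∷ 0F ∷ 1F ∷ []) ∷ (2F ∷ 1F ∷ 0F ∷ []) ∷ []

-- The last letter, the state, and for each relabelling ρ the derivative of
-- badType by the ρ-image of all letters before the last one.
Matcher : Set
Matcher = Fin 3 × State × List Exp

sameMatcher : WeaklyDecidable (_≡_ {A = Matcher})
sameMatcher (x , q , es) (y , r , fs) = Maybe.zipWith (cong₂ _,_) (dec⇒maybe (x Fin.≟ y))
  (Maybe.zipWith (cong₂ _,_) (dec⇒maybe (q Fin.≟ r)) (sameList sameExp es fs))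

derive : Fin 3 → List Exp → List Exp
derive x = zipWith (λ ρ → eat (lookup ρ x)) relabellings

match : Matcher → Bool → Matcher
match (x , q , es) d = x ▷ d , δ q d , derive x es

matches : Exp → Bool
matches e = isYes ([]∈? e)

-- Strings with one or two symbols are exempt, since `typeII` matches some of the latter.
agrees : Kind → Bool → Bool
agrees bad  b = b
agrees good b = not b
agrees _    _ = true

verdict : Matcher → Bool
verdict (x , q , es) = agrees (kind q) (any matches (derive x es))

matcher : Fin 3 → Matcher
matcher x = x , q₀ , map (λ _ → badType) relabellings

module Matching = Exploration sameMatcher match verdict

data Matched : Set where
  matching : ∀ {fuel} → Matching.explore fuel (map matcher (0F ∷ 1F ∷ 2F ∷ [])) [] ≡ true → Matched

all-matched : Matched
all-matched = matching {2000} refl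

eats : Vec (Fin 3) 3 → Exp → List (Fin 3) → Exp
eats ρ = foldl (λ e a → eat (lookup ρ a) e)

eats-sound : ∀ ρ e w → [] RE.∈ eats ρ e w → map (lookup ρ) w RE.∈ e
eats-sound ρ e []      m = m
eats-sound ρ e (a ∷ w) m = eat-sound (lookup ρ a) e (eats-sound ρ (eat (lookup ρ a) e) w m)

eats-complete : ∀ ρ e w → map (lookup ρ) w RE.∈ e → [] RE.∈ eats ρ e w
eats-complete ρ e []      m = m
eats-complete ρ e (a ∷ w) m = eats-complete ρ (eat (lookup ρ a) e) w (eat-complete (lookup ρ a) e m)

matcher-eats : ∀ (f : Vec (Fin 3) 3 → Exp) x q ds → let (y , _ , es) = foldl match (x , q , map f relabellings) ds in
  derive y es ≡ map (λ ρ → eats ρ (f ρ) (letters x ds)) relabellings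
matcher-eats f x q []       = refl
matcher-eats f x q (d ∷ ds) = matcher-eats (λ ρ → eat (lookup ρ x) (f ρ)) (x ▷ d) (δ q d) ds

state-matched : ∀ x q es ds → proj₁ (proj₂ (foldl match (x , q , es) ds)) ≡ run q ds
state-matched x q es []       = refl
state-matched x q es (d ∷ ds) = state-matched (x ▷ d) (δ q d) (derive x es) ds

kind-agrees : ∀ x ds → agrees (kind (run q₀ ds))
  (any matches (map (λ ρ → eats ρ badType (letters x ds)) relabellings)) ≡ true
kind-agrees x ds = subst₂ (λ q es → agrees (kind q) (any matches es) ≡ true)
  (state-matched x q₀ (map (λ _ → badType) relabellings) ds)
  (matcher-eats (λ _ → badType) x q₀ ds)
  (go all-matched)
  where
  start∈ : ∀ x → matcher x ∈ map matcher (0F ∷ 1F ∷ 2F ∷ [])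
  start∈ 0F = here refl
  start∈ 1F = there (here refl)
  start∈ 2F = there (there (here refl))
  go : Matched → verdict (foldl match (matcher x) ds) ≡ true
  go (matching {fuel} eq) = Matching.explore-sound fuel (map matcher (0F ∷ 1F ∷ 2F ∷ [])) eq (start∈ x) ds

-- `Bad` relabels a word of the expression into the string, whereas the matcher relabels the string;
-- the permutations are inverse to each other.
Undo : Vec (Fin 3) 3 → Set
Undo ρ = Σ[ π ∈ Permutation′ 3 ] (∀ a → π ⟨$⟩ʳ lookup ρ a ≡ a)

undo : ∀ ρ σ → Vec.map (lookup σ) ρ ≡ Vec.allFin 3 → Vec.map (lookup ρ) σ ≡ Vec.allFin 3 → Undo ρ
undo ρ σ σρ ρσ = permutation (lookup σ) (lookup ρ) (inverse ρ σ σρ) (inverse σ ρ ρσ) , inverse ρ σ σρ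
  where
  inverse : ∀ ρ σ → Vec.map (lookup σ) ρ ≡ Vec.allFin 3 → ∀ a → lookup σ (lookup ρ a) ≡ a
  inverse ρ σ eq a = trans (sym (Vec.lookup-map a (lookup σ) ρ))
    (trans (cong (λ v → lookup v a) eq) (Vec.lookup-allFin a))

relabellings-undo : All Undo relabellings
relabellings-undo =
    undo _ (0F ∷ 1F ∷ 2F ∷ []) refl refl ∷ undo _ (0F ∷ 2F ∷ 1F ∷ []) refl refl
  ∷ undo _ (1F ∷ 0F ∷ 2F ∷ []) refl refl ∷ undo _ (2F ∷ 0F ∷ 1F ∷ []) refl refl
  ∷ undo _ (1F ∷ 2F ∷ 0F ∷ []) refl refl ∷ undo _ (2F ∷ 1F ∷ 0F ∷ []) refl refl ∷ []

_∈ʳ?_ : (ρ : Vec (Fin 3) 3) (ρs : List (Vec (Fin 3) 3)) → Dec (ρ ∈ ρs)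
_∈ʳ?_ = DecMembership._∈?_ (Vec.≡-dec Fin._≟_)

relabellings-complete : ∀ a b c → a ≡ b ⊎ a ≡ c ⊎ b ≡ c ⊎ a ∷ b ∷ c ∷ [] ∈ relabellings
relabellings-complete = toWitness {a? = Fin.all? λ a → Fin.all? λ b → Fin.all? λ c →
  (a Fin.≟ b) ⊎-dec (a Fin.≟ c) ⊎-dec (b Fin.≟ c) ⊎-dec ((a ∷ b ∷ c ∷ []) ∈ʳ? relabellings)} tt

kind-bad : ∀ x ds → kind (run q₀ ds) ≡ bad → Bad (str x ds)
kind-bad x ds k≡bad with find (Any.map⁻ (any-true matches _
    (subst (λ k → agrees k (any matches (map (λ ρ → eats ρ badType (letters x ds)) relabellings)) ≡ true) k≡bad (kind-agrees x ds))))
... | ρ , ρ∈ , m with All.lookup relabellings-undo ρ∈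
...   | π , π∘ρ = π , map (lookup ρ) (letters x ds) ,
  eats-sound ρ badType (letters x ds) (toWitness {a? = []∈? eats ρ badType (letters x ds)} (subst T (sym m) tt)) ,
  trans (List.map-cong (λ a → cong toℕ (sym (π∘ρ a))) (letters x ds)) (List.map-∘ (letters x ds))

kind-good : ∀ x ds → kind (run q₀ ds) ≡ good → ¬ Bad (str x ds)
kind-good x ds k≡good (π , w , w∈ , eq) = refute (any-matches ρ∈)
  (subst (λ k → agrees k (any matches (map (λ ρ → eats ρ badType (letters x ds)) relabellings)) ≡ true) k≡good (kind-agrees x ds))
  where
  ρ : Vec (Fin 3) 3
  ρ = Vec.tabulate (π ⟨$⟩ˡ_)

  letters≡ : letters x ds ≡ map (π ⟨$⟩ʳ_) w
  letters≡ = List.map-injective Fin.toℕ-injective (trans eq (List.map-∘ w))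

  relabelled : map (lookup ρ) (letters x ds) ≡ w
  relabelled = begin
    map (lookup ρ) (letters x ds)              ≡⟨ cong (map (lookup ρ)) letters≡ ⟩
    map (lookup ρ) (map (π ⟨$⟩ʳ_) w)           ≡⟨ List.map-∘ w ⟨
    map (λ a → lookup ρ (π ⟨$⟩ʳ a)) w          ≡⟨ List.map-cong (λ a → trans (Vec.lookup∘tabulate (π ⟨$⟩ˡ_) (π ⟨$⟩ʳ a)) (inverseˡ π)) w ⟩
    map id w                                   ≡⟨ List.map-id w ⟩
    w                                          ∎
    where open ≡-Reasoning

  distinct : ∀ {a b} → a ≢ b → π ⟨$⟩ˡ a ≢ π ⟨$⟩ˡ b
  distinct a≢b eq′ = a≢b (trans (sym (inverseʳ π)) (trans (cong (π ⟨$⟩ʳ_) eq′) (inverseʳ π)))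

  ρ∈ : ρ ∈ relabellings
  ρ∈ with relabellings-complete (π ⟨$⟩ˡ 0F) (π ⟨$⟩ˡ 1F) (π ⟨$⟩ˡ 2F)
  ... | inj₁ e                 = contradiction e (distinct λ ())
  ... | inj₂ (inj₁ e)          = contradiction e (distinct λ ())
  ... | inj₂ (inj₂ (inj₁ e))   = contradiction e (distinct λ ())
  ... | inj₂ (inj₂ (inj₂ ρ∈′)) = ρ∈′

  any-matches : ∀ {ρs} → ρ ∈ ρs → T (any matches (map (λ ρ → eats ρ badType (letters x ds)) ρs))
  any-matches ρ∈ρs = Any.any⁺ matches (Any.map⁺ (Any.map (λ { refl → fromWitness {a? = []∈? eats ρ badType (letters x ds)}
    (eats-complete ρ badType (letters x ds) (subst (RE._∈ badType) (sym relabelled) w∈)) }) ρ∈ρs))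

  refute : ∀ {b} → T b → ¬ not b ≡ true
  refute {true} _ ()

-- A stack program

-- A deterministic choice of improving flips on a stack machine, for any finite
-- set C of word classes and any test deciding a flip of ds = u ++ d ∷ v from the
-- classes of ds, reflect u and v and the sum of u ++ d ∷ [].
module Machine {C : Set} {m : ℕ} (code : C → Fin m) (decode : Fin m → C)
  (decode-code : ∀ c → decode (code c) ≡ c)
  (nil : C) (cons : Bool → C → C) (test : C → C → Fin 3 → C → Bool)
  (measure : List Bool → ℕ) where

  wordClass : List Bool → C
  wordClass = foldr cons nil

  accepts : List Bool → List Bool → Bool → List Bool → Bool
  accepts ds u d v = test (wordClass ds) (wordClass (reflect u)) (end 0F u ▷ d) (wordClass v)

  data Chosen (ds : List Bool) : List ℕ → Set where
    stop : (∀ u d v → ds ≡ u ++ d ∷ v → accepts ds u d v ≡ false) → Chosen ds []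
    next : ∀ u d v {is} → ds ≡ u ++ d ∷ v → accepts ds u d v ≡ true →
      Chosen (flipped u d v) is → Chosen ds (suc (length u) ∷ is)

  Symbol : Set
  Symbol = Fin (3 + m)

  Prog : Set
  Prog = Program 8 (3 + m)

  letter : Fin 3 → Symbol
  letter = _↑ˡ m

  bit : Bool → Symbol
  bit true  = 1F
  bit false = 2F

  bits : List Bool → List Symbol
  bits = map bit

  class : C → Symbol
  class c = 3 ↑ʳ code c

  -- The decoders are total; in the runs considered below each meets a symbol of its own sort, so
  -- their default values never occur.
  toLetter : Maybe Symbol → Fin 3
  toLetter (just 0F)            = 0F
  toLetter (just 1F)            = 1F
  toLetter (just (suc (suc _))) = 2F
  toLetter nothing              = 0F

  toBit : Maybe Symbol → Bool
  toBit (just 1F) = true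
  toBit _         = false

  toClass : Maybe Symbol → C
  toClass (just (suc (suc (suc c)))) = decode c
  toClass _                          = nil

  toLetter-letter : ∀ x → toLetter (just (letter x)) ≡ x
  toLetter-letter 0F = refl
  toLetter-letter 1F = refl
  toLetter-letter 2F = refl

  toBit-bit : ∀ d → toBit (just (bit d)) ≡ d
  toBit-bit true  = refl
  toBit-bit false = refl

  toClass-class : ∀ c → toClass (just (class c)) ≡ c
  toClass-class = decode-code

  -- Stack 0 holds the input and the output, 1 the previous input letter,
  -- 2 the reversed difference word, 3 the unread part of that word, each
  -- letter above the class of what follows it, 4 the mirror image of the part
  -- already read, 5 the class of the word, 6 the class of stack 4 above the
  -- sum of the letters read, and 7 the reversed output.

  emit : List Bool → Prog
  emit []       = skip
  emit (d ∷ ds) = push 2F (bit d) ⨾ emit ds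

  difference : Maybe Symbol → Fin 3 → List Bool
  difference nothing  y = []
  difference (just x) y = joint (toLetter (just x)) y

  readLetter annotate unwind restore search round output : Prog
  readLetter = pop 0F λ a → pop 1F λ l →
    push 1F (letter (toLetter a)) ⨾ emit (difference l (toLetter a))
  annotate = pop 2F λ a → pop 5F λ g →
    push 3F (class (toClass g)) ⨾ push 3F (bit (toBit a)) ⨾ push 5F (class (cons (toBit a) (toClass g)))
  unwind = pop 4F λ a → push 2F (bit (toBit a)) ⨾ push 7F 1F
  restore = pop 3F λ a → pop 3F λ _ → push 2F (bit (toBit a))

  -- Control flow lies in the stacks: restoring empties stack 3, which ends the search, and leaves
  -- the flipped word on stack 2 for the next round. A search without success leaves stack 2 empty,
  -- which ends the rounds.
  commit : Fin 3 → Prog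
  -- The initial `1` reflects that the flipped prefix has one letter more than differences;
  -- unwinding writes the others.
  commit y = push 7F 1F ⨾ while 4F unwind ⨾ push 7F 0F ⨾ emit (joint 0F y) ⨾ while 3F restore

  advance : C → Fin 3 → Bool → Prog
  advance f y d = push 4F (bit (not d)) ⨾ push 6F (letter (y ▷ d)) ⨾ push 6F (class (cons (not d) f))

  decide : C → C → Fin 3 → Bool → C → Prog
  decide t f y d g = if test t f (y ▷ d) g then commit (y ▷ d) else advance f y d

  search = pop 3F λ a → pop 3F λ g → pop 6F λ f → pop 6F λ y → pop 5F λ t →
    push 5F (class (toClass t)) ⨾ decide (toClass t) (toClass f) (toLetter y) (toBit a) (toClass g)
  round = pop 5F λ _ → push 5F (class nil) ⨾ while 2F annotate ⨾
    push 6F (letter 0F) ⨾ push 6F (class nil) ⨾ while 3F search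
  output = pop 7F λ a → push 0F (Maybe.fromMaybe 0F a)

  program : Prog
  program = while 0F readLetter ⨾ while 2F round ⨾ while 7F output

  Stack : Set
  Stack = List Symbol

  stacks : (I L R Q P G F O : Stack) → Stacks 8 (3 + m)
  stacks I L R Q P G F O = I ∷ L ∷ R ∷ Q ∷ P ∷ G ∷ F ∷ O ∷ []

  record Run (P : Prog) (σ τ : Stacks 8 (3 + m)) (b : ℕ) : Set where
    constructor ran
    field
      {time} : ℕ
      trace  : ⟨ P , σ ⟩⇓[ time ] τ
      bound  : time ≤ b

  weaken : ∀ {P σ τ b c} → b ≤ c → Run P σ τ b → Run P σ τ c
  weaken b≤c (ran trace bound) = ran trace (ℕ.≤-trans bound b≤c)

  skip-run : ∀ {σ} → Run skip σ σ 1
  skip-run = ran skip ℕ.≤-refl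

  push-run : ∀ {σ i a} → Run (push i a) σ (σ [ i ]%= (a ∷_)) 1
  push-run = ran push ℕ.≤-refl

  pop-run : ∀ {σ τ i P b} → Run (P (head (lookup σ i))) (σ [ i ]%= drop 1) τ b → Run (pop i P) σ τ (suc b)
  pop-run (ran trace bound) = ran (pop trace) (s≤s bound)

  infixr 5 _then_

  _then_ : ∀ {P Q σ ρ τ b c} → Run P σ ρ b → Run Q ρ τ c → Run (P ⨾ Q) σ τ (b + c)
  ran p p≤ then ran q q≤ = ran (seq p q) (ℕ.+-mono-≤ p≤ q≤)

  stop-run : ∀ {σ i P} → lookup σ i ≡ [] → Run (while i P) σ σ 1
  stop-run empty = ran (stop empty) ℕ.≤-refl

  loop-run : ∀ {σ ρ τ i P b c} → lookup σ i ≢ [] → Run P σ ρ b → Run (while i P) ρ τ c →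
    Run (while i P) σ τ (suc (b + c))
  loop-run nonempty (ran p p≤) (ran q q≤) = ran (loop nonempty p q) (s≤s (ℕ.+-mono-≤ p≤ q≤))

  emit-run : ∀ ds {I L R Q P G F O} →
    Run (emit ds) (stacks I L (bits R) Q P G F O) (stacks I L (bits (ds ʳ++ R)) Q P G F O) (suc (length ds))
  emit-run []       = skip-run
  emit-run (d ∷ ds) = push-run then emit-run ds

  emit-joint : ∀ x y {I L R Q P G F O} →
    Run (emit (joint x y)) (stacks I L (bits R) Q P G F O) (stacks I L (bits (joint x y ʳ++ R)) Q P G F O) 2
  emit-joint x y = weaken (s≤s (length-joint x y)) (emit-run (joint x y))

  read-first : ∀ y {I R Q P G F O} →
    Run readLetter (stacks (letter y ∷ I) [] (bits R) Q P G F O) (stacks I (letter y ∷ []) (bits R) Q P G F O) 4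
  -- The popped value equals `y` only up to a proof, so `go` takes it as a variable and matches on
  -- the equation. The same device recurs in the runs below.
  read-first y = pop-run (pop-run (go _ (toLetter-letter y)))
    where
    go : ∀ y′ → y′ ≡ y → ∀ {I R Q P G F O} → Run (push 1F (letter y′) ⨾ skip)
      (stacks I [] (bits R) Q P G F O) (stacks I (letter y ∷ []) (bits R) Q P G F O) 2
    go _ refl = push-run then skip-run

  read-next : ∀ x y {I R Q P G F O} →
    Run readLetter (stacks (letter y ∷ I) (letter x ∷ []) (bits R) Q P G F O)
      (stacks I (letter y ∷ []) (bits (joint x y ʳ++ R)) Q P G F O) 5
  read-next x y = pop-run (pop-run (go _ _ (toLetter-letter x) (toLetter-letter y)))
    where
    go : ∀ x′ y′ → x′ ≡ x → y′ ≡ y → ∀ {I R Q P G F O} → Run (push 1F (letter y′) ⨾ emit (joint x′ y′))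
      (stacks I [] (bits R) Q P G F O) (stacks I (letter y ∷ []) (bits (joint x y ʳ++ R)) Q P G F O) 3
    go _ _ refl refl = push-run then emit-joint x y

  read-run : ∀ x w {R Q P G F O} →
    ∃[ L ] Run (while 0F readLetter) (stacks (map letter w) (letter x ∷ []) (bits R) Q P G F O)
      (stacks [] L (bits (diffs x w ʳ++ R)) Q P G F O) (length w * 6 + 1)
  read-run x []      = _ , stop-run refl
  read-run x (y ∷ w) {R} {Q} {P} {G} {F} {O} with read-run y w {joint x y ʳ++ R} {Q} {P} {G} {F} {O}
  ... | L , rest = L , subst
    (λ ds → Run (while 0F readLetter) (stacks (map letter (y ∷ w)) (letter x ∷ []) (bits R) Q P G F O)
      (stacks [] L (bits ds) Q P G F O) (length (y ∷ w) * 6 + 1))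
    (sym (List.++-ʳ++ (joint x y))) (loop-run (λ ()) (read-next x y) rest)

  annotated : List Bool → Stack
  annotated []      = []
  annotated (d ∷ v) = bit d ∷ class (wordClass v) ∷ annotated v

  annotate-step : ∀ d v {I L R P F O} →
    Run annotate (stacks I L (bit d ∷ R) (annotated v) P (class (wordClass v) ∷ []) F O)
      (stacks I L R (annotated (d ∷ v)) P (class (wordClass (d ∷ v)) ∷ []) F O) 5
  annotate-step d v = pop-run (pop-run (go _ _ (toBit-bit d) (toClass-class (wordClass v))))
    where
    go : ∀ d′ c → d′ ≡ d → c ≡ wordClass v → ∀ {I L R P F O} →
      Run (push 3F (class c) ⨾ push 3F (bit d′) ⨾ push 5F (class (cons d′ c)))
        (stacks I L R (annotated v) P [] F O)
        (stacks I L R (annotated (d ∷ v)) P (class (wordClass (d ∷ v)) ∷ []) F O) 3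
    go _ _ refl refl = push-run then push-run then push-run

  -- Stack 2 has the last difference on top, so one pass from right to left yields the classes of
  -- all suffixes by `cons`.
  annotate-run : ∀ r v {I L P F O} →
    Run (while 2F annotate) (stacks I L (bits r) (annotated v) P (class (wordClass v) ∷ []) F O)
      (stacks I L [] (annotated (r ʳ++ v)) P (class (wordClass (r ʳ++ v)) ∷ []) F O) (length r * 6 + 1)
  annotate-run []      v = stop-run refl
  annotate-run (d ∷ r) v = loop-run (λ ()) (annotate-step d v) (annotate-run r (d ∷ v))

  unwind-step : ∀ d {I L R Q P G F O} →
    Run unwind (stacks I L R Q (bit d ∷ P) G F O) (stacks I L (bit d ∷ R) Q P G F (1F ∷ O)) 3
  unwind-step d = pop-run (go _ (toBit-bit d))
    where
    go : ∀ d′ → d′ ≡ d → ∀ {I L R Q P G F O} → Run (push 2F (bit d′) ⨾ push 7F 1F)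
      (stacks I L R Q P G F O) (stacks I L (bit d ∷ R) Q P G F (1F ∷ O)) 2
    go _ refl = push-run then push-run

  unwind-run : ∀ p {I L R Q G F O} →
    Run (while 4F unwind) (stacks I L (bits R) Q (bits p) G F O)
      (stacks I L (bits (p ʳ++ R)) Q [] G F (replicate (length p) 1F ʳ++ O)) (length p * 4 + 1)
  unwind-run []      = stop-run refl
  unwind-run (d ∷ p) {R = R} = loop-run (λ ()) (unwind-step d) (unwind-run p {R = d ∷ R})

  restore-step : ∀ d v {I L R P G F O} →
    Run restore (stacks I L R (annotated (d ∷ v)) P G F O) (stacks I L (bit d ∷ R) (annotated v) P G F O) 3
  restore-step d v = pop-run (pop-run (go _ (toBit-bit d)))
    where
    go : ∀ d′ → d′ ≡ d → ∀ {I L R Q P G F O} → Run (push 2F (bit d′))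
      (stacks I L R Q P G F O) (stacks I L (bit d ∷ R) Q P G F O) 1
    go _ refl = push-run

  restore-run : ∀ v {I L R P G F O} →
    Run (while 3F restore) (stacks I L (bits R) (annotated v) P G F O)
      (stacks I L (bits (v ʳ++ R)) [] P G F O) (length v * 4 + 1)
  restore-run []      = stop-run refl
  restore-run (d ∷ v) {R = R} = loop-run (λ ()) (restore-step d v) (restore-run v {R = d ∷ R})

  printed : ℕ → Stack → Stack
  printed i O = (replicate i 1F ++ 0F ∷ []) ʳ++ O

  commit-run : ∀ p y v {I L G F O} →
    Run (commit y) (stacks I L [] (annotated v) (bits p) G F O)
      (stacks I L (bits (reverse (p ++ joint 0F y ++ v))) [] [] G F (printed (suc (length p)) O))
      (6 + (length p * 4 + length v * 4))
  commit-run p y v {I} {L} {G} {F} {O} = weaken (ℕ.≤-reflexive (time (length p * 4) (length v * 4)))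
    (subst₂ (λ r o → Run (commit y) (stacks I L [] (annotated v) (bits p) G F O)
        (stacks I L (bits r) [] [] G F o) _)
      (sym (trans (List.++-ʳ++ p) (List.++-ʳ++ (joint 0F y))))
      (sym (List.++-ʳ++ (replicate (suc (length p)) 1F)))
      (push-run then unwind-run p {R = []} then push-run then emit-joint 0F y {R = p ʳ++ []}
        then restore-run v {R = joint 0F y ʳ++ (p ʳ++ [])}))
    where
    time : ∀ a b → 1 + (a + 1 + (1 + (2 + (b + 1)))) ≡ 6 + (a + b)
    time = solve-∀

  searching : C → List Bool → List Bool → (I L O : Stack) → Stacks 8 (3 + m)
  searching t u w I L O = stacks I L [] (annotated w) (bits (reflect u)) (class t ∷ [])
    (class (wordClass (reflect u)) ∷ letter (end 0F u) ∷ []) O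

  reflect-∷ʳ : ∀ u d → reflect (u ++ d ∷ []) ≡ not d ∷ reflect u
  reflect-∷ʳ []      d = refl
  reflect-∷ʳ (e ∷ u) d = cong (_++ not e ∷ []) (reflect-∷ʳ u d)

  accepted : C → List Bool → Bool → List Bool → Bool
  accepted t u d v = test t (wordClass (reflect u)) (end 0F u ▷ d) (wordClass v)

  decide-run : ∀ t u d v {I L O τ b} →
    Run (decide t (wordClass (reflect u)) (end 0F u) d (wordClass v))
      (stacks I L [] (annotated v) (bits (reflect u)) (class t ∷ []) [] O) τ b →
    Run search (searching t u (d ∷ v) I L O) τ (6 + b)
  decide-run t u d v {I} {L} {O} {τ} {b} run = pop-run (pop-run (pop-run (pop-run (pop-run
    (go _ _ _ _ _ (toClass-class t) (toClass-class _) (toLetter-letter _) (toBit-bit d) (toClass-class _))))))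
    where
    go : ∀ t′ f y d′ g → t′ ≡ t → f ≡ wordClass (reflect u) → y ≡ end 0F u → d′ ≡ d → g ≡ wordClass v →
      Run (push 5F (class t′) ⨾ decide t′ f y d′ g)
        (stacks I L [] (annotated v) (bits (reflect u)) [] [] O) τ (1 + b)
    go _ _ _ _ _ refl refl refl refl refl = push-run then run

  advance-run : ∀ t u d v {I L O} →
    Run (advance (wordClass (reflect u)) (end 0F u) d)
      (stacks I L [] (annotated v) (bits (reflect u)) (class t ∷ []) [] O)
      (searching t (u ++ d ∷ []) v I L O) 3
  advance-run t u d v {I} {L} {O} = subst₂
    (λ r y → Run (advance (wordClass (reflect u)) (end 0F u) d)
      (stacks I L [] (annotated v) (bits (reflect u)) (class t ∷ []) [] O)
      (stacks I L [] (annotated v) (bits r) (class t ∷ []) (class (wordClass r) ∷ letter y ∷ []) O) 3)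
    (sym (reflect-∷ʳ u d)) (sym (end-∷ʳ 0F u d))
    (push-run then push-run then push-run)

  data Outcome (t : C) (I L O : Stack) (u w : List Bool) : Stacks 8 (3 + m) → Set where
    found : ∀ x d v → w ≡ x ++ d ∷ v → accepted t (u ++ x) d v ≡ true →
      Outcome t I L O u w (stacks I L (bits (reverse (flipped (u ++ x) d v))) [] [] (class t ∷ []) []
        (printed (suc (length (u ++ x))) O))
    missed : ∀ {P F} → (∀ x d v → w ≡ x ++ d ∷ v → accepted t (u ++ x) d v ≡ false) →
      Outcome t I L O u w (stacks I L [] [] P (class t ∷ []) F O)

  Outcome-∷ : ∀ {t I L O} u d w {τ} → accepted t u d w ≡ false →
    Outcome t I L O (u ++ d ∷ []) w τ → Outcome t I L O u (d ∷ w) τ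
  Outcome-∷ {t} {I} {L} {O} u d w _ (found x e v refl ok) = subst
    (λ u′ → accepted t u′ e v ≡ true → Outcome t I L O u (d ∷ w)
      (stacks I L (bits (reverse (flipped u′ e v))) [] [] (class t ∷ []) [] (printed (suc (length u′)) O)))
    (sym (List.++-assoc u (d ∷ []) x)) (found (d ∷ x) e v refl) ok
  Outcome-∷ {t} u d w rejected (missed none) = missed λ where
    []      e v refl → subst (λ u′ → accepted t u′ e v ≡ false) (sym (List.++-identityʳ u)) rejected
    (_ ∷ x) e v refl → subst (λ u′ → accepted t u′ e v ≡ false) (List.++-assoc u (d ∷ []) x) (none x e v refl)

  -- With `a` letters read and `b` unread: a letter costs 4 when it is moved back after a hit, and
  -- an unread one may first cost 10 to step over.
  search-time : ℕ → ℕ → ℕ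
  search-time a b = 8 + (a * 4 + b * 14)

  decided : ∀ t f y d g b {σ τ n} → test t f (y ▷ d) g ≡ b →
    Run (if b then commit (y ▷ d) else advance f y d) σ τ n → Run (decide t f y d g) σ τ n
  decided t f y d g b {σ} {τ} {n} eq =
    subst (λ b → Run (if b then commit (y ▷ d) else advance f y d) σ τ n) (sym eq)

  hit-run : ∀ t u d v {I L O} → accepted t u d v ≡ true → ∃[ τ ]
    (Run (while 3F search) (searching t u (d ∷ v) I L O) τ (search-time (length u) (suc (length v))) × Outcome t I L O u (d ∷ v) τ)
  hit-run t u d v {I} {L} {O} eq = stacks I L (bits (reverse (flipped (u ++ []) d v))) [] [] (class t ∷ []) []
      (printed (suc (length (u ++ []))) O) ,
    subst₂ (λ u′ n → Run (while 3F search) (searching t u (d ∷ v) I L O)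
        (stacks I L (bits (reverse (flipped u′ d v))) [] [] (class t ∷ []) [] (printed (suc (length u′)) O))
        (search-time n (suc (length v))))
      (sym (List.++-identityʳ u)) (length-reflect u)
      (subst (λ n → Run (while 3F search) (searching t u (d ∷ v) I L O)
          (stacks I L (bits (reverse (flipped u d v))) [] [] (class t ∷ []) [] (printed (suc n) O))
          (search-time (length (reflect u)) (suc (length v))))
        (length-reflect u)
        (weaken (time (length (reflect u)) (length v))
          (loop-run (λ ()) (decide-run t u d v (decided t _ _ d _ true eq (commit-run (reflect u) (end 0F u ▷ d) v)))
            (stop-run refl)))) ,
    found [] d v refl (subst (λ u′ → accepted t u′ d v ≡ true) (sym (List.++-identityʳ u)) eq)
    where
    slack : ∀ a b → 1 + (6 + (6 + (a * 4 + b * 4)) + 1) + (8 + b * 10) ≡ 8 + (a * 4 + (1 + b) * 14)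
    slack = solve-∀
    time : ∀ a b → suc (6 + (6 + (a * 4 + b * 4)) + 1) ≤ search-time a (suc b)
    time a b = ℕ.≤-trans (ℕ.m≤m+n _ (8 + b * 10)) (ℕ.≤-reflexive (slack a b))

  search-run : ∀ t u w {I L O} → ∃[ τ ]
    (Run (while 3F search) (searching t u w I L O) τ (search-time (length u) (length w)) × Outcome t I L O u w τ)
  search-run t u []      = _ , weaken (s≤s z≤n) (stop-run refl) , missed λ where
    []      d v ()
    (_ ∷ _) d v ()
  search-run t u (d ∷ v) {I} {L} {O} = go (accepted t u d v) refl (search-run t (u ++ d ∷ []) v)
    where
    time : ∀ a b → 10 + (8 + ((1 + a) * 4 + b * 14)) ≡ 8 + (a * 4 + (1 + b) * 14)
    time = solve-∀
    time′ : suc (6 + 3 + search-time (length (u ++ d ∷ [])) (length v)) ≡ search-time (length u) (suc (length v))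
    time′ = trans
      (cong (λ n → suc (6 + 3 + search-time n (length v))) (trans (List.length-++ u) (ℕ.+-comm (length u) 1)))
      (time (length u) (length v))

    go : ∀ b → accepted t u d v ≡ b → ∃[ τ ] (Run (while 3F search) (searching t (u ++ d ∷ []) v I L O) τ
        (search-time (length (u ++ d ∷ [])) (length v)) × Outcome t I L O (u ++ d ∷ []) v τ) →
      ∃[ τ ] (Run (while 3F search) (searching t u (d ∷ v) I L O) τ
        (search-time (length u) (suc (length v))) × Outcome t I L O u (d ∷ v) τ)
    go true  eq _                     = hit-run t u d v eq
    go false eq (τ , rest , outcome) = τ ,
      weaken (ℕ.≤-reflexive time′)
        (loop-run (λ ()) (decide-run t u d v (decided t _ _ d _ false eq (advance-run t u d v))) rest) ,
      Outcome-∷ u d v eq outcome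

  -- The premise on `G` covers both the first round, where stack 5 is empty, and later ones, where
  -- it holds the class of the previous word. The factor 20 is 6 for annotating plus 14 for
  -- searching.
  round-run : ∀ r {L G O} → drop 1 G ≡ [] → let ds = reverse r in ∃[ τ ]
    (Run round (stacks [] L (bits r) [] [] G [] O) τ (13 + length r * 20) ×
     Outcome (wordClass ds) [] L O [] ds τ)
  round-run r {L} {G} {O} G≡ with search-run (wordClass (reverse r)) [] (reverse r) {[]} {L} {O}
  ... | τ , run , outcome = τ ,
    weaken (ℕ.≤-reflexive (trans (cong (λ n → 1 + (1 + (length r * 6 + 1 + (1 + (1 + search-time 0 n))))) (List.length-reverse r)) (time (length r))))
      (pop-run (reset then annotate-run r [] then push-run then push-run then run)) ,
    outcome
    where
    time : ∀ n → 1 + (1 + (n * 6 + 1 + (1 + (1 + (8 + (0 * 4 + n * 14)))))) ≡ 13 + n * 20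
    time = solve-∀
    reset : Run (push 5F (class nil)) (stacks [] L (bits r) [] [] (drop 1 G) [] O)
      (stacks [] L (bits r) [] [] (class nil ∷ []) [] O) 1
    reset = subst (λ G′ → Run (push 5F (class nil)) (stacks [] L (bits r) [] [] G′ [] O)
      (stacks [] L (bits r) [] [] (class nil ∷ []) [] O) 1) (sym G≡) push-run

  Decreasing : Set
  Decreasing = ∀ u d v → accepts (u ++ d ∷ v) u d v ≡ true → measure (flipped u d v) < measure (u ++ d ∷ v)

  -- `n` bounds the measure and thus the number of flips, `B` the word length. The factor `suc n`
  -- counts the final unsuccessful round; a flip is written with at most `B` ones and a closing 0.
  record Grouped (n B : ℕ) (r : List Bool) (L G O : Stack) : Set where
    field
      flips         : List ℕ
      {Q P G′ F}    : Stack
      runs          : Run (while 2F round) (stacks [] L (bits r) [] [] G [] O)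
                        (stacks [] L [] Q P G′ F (encode m flips ʳ++ O)) (suc n * (16 + B * 20) + 1)
      chosen        : Chosen (reverse r) flips
      output-length : length (encode m flips) ≤ n * suc B

  printed-first : ∀ i is O → encode m is ʳ++ printed i O ≡ encode m (i ∷ is) ʳ++ O
  printed-first i is O = sym (List.++-ʳ++ (replicate i 1F ++ 0F ∷ []))

  length-printed : ∀ i is → length (encode m (i ∷ is)) ≡ suc i + length (encode m is)
  length-printed i is = begin
    length ((replicate i 1F ++ 0F ∷ []) ++ encode m is)             ≡⟨ List.length-++ (replicate i 1F ++ 0F ∷ []) ⟩
    length (replicate i 1F ++ 0F ∷ []) + length (encode m is)       ≡⟨ cong (_+ length (encode m is)) (List.length-++ (replicate i 1F)) ⟩
    length (replicate i 1F) + 1 + length (encode m is)              ≡⟨ cong (λ k → k + 1 + length (encode m is)) (List.length-replicate i) ⟩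
    i + 1 + length (encode m is)                                    ≡⟨ cong (_+ length (encode m is)) (ℕ.+-comm i 1) ⟩
    suc i + length (encode m is)                                    ∎
    where open ≡-Reasoning

  Groups : ℕ → ℕ → Set
  Groups n B = ∀ r {L G O} → measure (reverse r) ≤ n → length r ≤ B → drop 1 G ≡ [] → Grouped n B r L G O

  -- The recursive call is a parameter because `n` is known to be a successor only once a flip is
  -- found and the measure has dropped.
  group-next : Decreasing → ∀ n B → (∀ k → n ≡ suc k → Groups k B) → Groups n B
  group-next dec n B rec [] {L} {G} {O} _ _ _ = record
    { flips         = []
    ; runs          = weaken (ℕ.m≤n+m 1 (suc n * (16 + B * 20))) (stop-run refl)
    ; chosen        = stop λ { [] d v () ; (_ ∷ _) d v () }
    ; output-length = z≤n
    }
  group-next dec n B rec r@(_ ∷ _) {L} {G} {O} μ≤n r≤B G≡ = go (round-run r {L} {G} {O} G≡)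
    where
    round-time : 14 + length r * 20 ≤ 16 + B * 20
    round-time = ℕ.+-mono-≤ (ℕ.m≤n+m 14 2) (ℕ.*-monoˡ-≤ 20 r≤B)

    missed-time : suc (13 + length r * 20 + 1) ≤ suc n * (16 + B * 20) + 1
    missed-time = ℕ.+-monoˡ-≤ 1 (ℕ.≤-trans round-time (ℕ.m≤m+n (16 + B * 20) (n * (16 + B * 20))))

    found-time : ∀ k → suc (13 + length r * 20 + (k * (16 + B * 20) + 1)) ≤ suc k * (16 + B * 20) + 1
    found-time k = begin
      14 + length r * 20 + (k * (16 + B * 20) + 1)   ≤⟨ ℕ.+-monoˡ-≤ _ round-time ⟩
      16 + B * 20 + (k * (16 + B * 20) + 1)          ≡⟨ ℕ.+-assoc (16 + B * 20) (k * (16 + B * 20)) 1 ⟨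
      suc k * (16 + B * 20) + 1                      ∎
      where open ℕ.≤-Reasoning

    extend : ∀ k u d v → n ≡ suc k → measure (flipped u d v) ≤ k → reverse r ≡ u ++ d ∷ v →
      accepts (reverse r) u d v ≡ true →
      Run round (stacks [] L (bits r) [] [] G [] O)
        (stacks [] L (bits (reverse (flipped u d v))) [] [] (class (wordClass (reverse r)) ∷ []) []
          (printed (suc (length u)) O)) (13 + length r * 20) →
      Grouped n B r L G O
    extend k u d v refl μ≤k eq ok run = record
      { flips         = suc (length u) ∷ flips
      ; runs          = subst (λ O′ → Run (while 2F round) (stacks [] L (bits r) [] [] G [] O)
                          (stacks [] L [] Q P G′ F O′) (suc n * (16 + B * 20) + 1))
                          (printed-first (suc (length u)) flips O)
                          (weaken (found-time (suc k)) (loop-run (λ ()) run runs))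
      ; chosen        = next u d v eq ok (subst (λ ds → Chosen ds flips) (List.reverse-involutive (flipped u d v)) chosen)
      ; output-length = ℕ.≤-trans (ℕ.≤-reflexive (length-printed (suc (length u)) flips))
                          (ℕ.+-mono-≤ (s≤s u<B) output-length)
      }
      where
      ds≤B : length (u ++ d ∷ v) ≤ B
      ds≤B = subst (_≤ B) (trans (sym (List.length-reverse r)) (cong length eq)) r≤B
      u<B : suc (length u) ≤ B
      u<B = ℕ.≤-trans (s≤s (ℕ.m≤m+n (length u) (length v))) (subst (_≤ B) (length-insert u d v) ds≤B)
      open Grouped (rec k refl (reverse (flipped u d v))
        {L} {class (wordClass (reverse r)) ∷ []} {printed (suc (length u)) O}
        (subst (λ ds → measure ds ≤ k) (sym (List.reverse-involutive (flipped u d v))) μ≤k)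
        (ℕ.≤-trans (ℕ.≤-reflexive (List.length-reverse (flipped u d v))) (ℕ.≤-trans (length-flipped-≤ u d v) ds≤B))
        refl)

    go : ∃[ τ ] (Run round (stacks [] L (bits r) [] [] G [] O) τ (13 + length r * 20) ×
           Outcome (wordClass (reverse r)) [] L O [] (reverse r) τ) → Grouped n B r L G O
    go (_ , run , found u d v eq ok) with ℕ.≤-trans
      (subst (λ ds → suc (measure (flipped u d v)) ≤ measure ds) (sym eq)
        (dec u d v (subst (λ ds → accepts ds u d v ≡ true) eq ok))) μ≤n
    ... | s≤s μ≤k = extend _ u d v refl μ≤k eq ok run
    go (_ , run , missed none) = record
      { flips         = []
      ; runs          = weaken missed-time (loop-run (λ ()) run (stop-run refl))
      ; chosen        = stop none
      ; output-length = z≤n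
      }

  group : Decreasing → ∀ n B → Groups n B
  group dec zero    B = group-next dec zero B λ _ ()
  group dec (suc n) B = group-next dec (suc n) B λ { .n refl → group dec n B }

  output-run : ∀ O {I L R Q P G F} →
    Run (while 7F output) (stacks I L R Q P G F O) (stacks (O ʳ++ I) L R Q P G F []) (length O * 3 + 1)
  output-run []      = stop-run refl
  output-run (a ∷ O) = loop-run (λ ()) (pop-run push-run) (output-run O)

  Solves : List (Fin 3) → List ℕ → Set
  Solves []      is = is ≡ []
  Solves (x ∷ w) is = Chosen (diffs x w) is

  program-run : Decreasing → (∀ ds → measure ds ≤ length ds) → ∀ w → ∃[ is ] ∃[ t ] ∃[ τ ]
    ( ⟨ program , initial 7 m w ⟩⇓[ t ] τ × t ≤ 45 * length w ^ 2 + 45 × Vec.head τ ≡ encode m is × Solves w is)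
  program-run dec bounded [] = [] , 3 , _ , seq (stop refl) (seq (stop refl) (stop refl)) , s≤s (s≤s (s≤s z≤n)) , refl , refl
  program-run dec bounded (x ∷ w) with read-run x w {[]} {[]} {[]} {[]} {[]} {[]}
  ... | L , reads = flips , Run.time total , _ , Run.trace total ,
      ℕ.≤-trans (Run.bound total) time ,
      List.reverse-involutive (encode m flips) ,
      subst (λ ds → Chosen ds flips) (List.reverse-involutive (diffs x w)) chosen
    where
    l : ℕ
    l = length w
    open Grouped (group dec l l (reverse (diffs x w)) {L} {[]} {[]}
      (subst (λ ds → measure ds ≤ l) (sym (List.reverse-involutive (diffs x w)))
        (ℕ.≤-trans (bounded (diffs x w)) (length-diffs x w)))
      (ℕ.≤-trans (ℕ.≤-reflexive (List.length-reverse (diffs x w))) (length-diffs x w)) refl)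

    O : Stack
    O = encode m flips ʳ++ []

    total : Run program (initial 7 m (x ∷ w)) (stacks (O ʳ++ []) L [] Q P G′ F [])
      (suc (4 + (l * 6 + 1)) + (suc l * (16 + l * 20) + 1 + (length O * 3 + 1)))
    total = loop-run (λ ()) (read-first x {R = []}) reads then runs then output-run O

    -- The time bound is `23 n² + 45 n + 24` with `n` one less than the input length; the constant
    -- 45 is its largest coefficient.
    slack : ∀ n → 6 + (n * 6) + ((1 + n) * (16 + n * 20) + 1 + (n * (1 + n) * 3 + 1)) + (66 + 45 * n + 22 * n * n)
      ≡ 45 * ((1 + n) * ((1 + n) * 1)) + 45
    slack = solve-∀

    time : suc (4 + (l * 6 + 1)) + (suc l * (16 + l * 20) + 1 + (length O * 3 + 1)) ≤ 45 * suc l ^ 2 + 45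
    time = begin
      suc (4 + (l * 6 + 1)) + (suc l * (16 + l * 20) + 1 + (length O * 3 + 1))
        ≡⟨ cong₂ (λ a b → suc (4 + a) + (suc l * (16 + l * 20) + 1 + (b * 3 + 1)))
             (ℕ.+-comm (l * 6) 1) (List.length-reverse (encode m flips)) ⟩
      6 + l * 6 + (suc l * (16 + l * 20) + 1 + (length (encode m flips) * 3 + 1))
        ≤⟨ ℕ.+-monoʳ-≤ (6 + l * 6) (ℕ.+-monoʳ-≤ (suc l * (16 + l * 20) + 1) (ℕ.+-monoˡ-≤ 1 (ℕ.*-monoˡ-≤ 3 output-length))) ⟩
      6 + l * 6 + (suc l * (16 + l * 20) + 1 + (l * suc l * 3 + 1))
        ≤⟨ ℕ.m≤m+n _ (66 + 45 * l + 22 * l * l) ⟩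
      6 + l * 6 + (suc l * (16 + l * 20) + 1 + (l * suc l * 3 + 1)) + (66 + 45 * l + 22 * l * l)
        ≡⟨ slack l ⟩
      45 * suc l ^ 2 + 45 ∎
      where open ℕ.≤-Reasoning

-- The test for improving flips, and the passage from strings to words of differences

test : Class → Class → Fin 3 → Class → Bool
-- Transition functions compose: `q₀` passes through the mirror image by `f`, over the junction, and
-- through the suffix by `g`.
test t f y g = improves (lookup t q₀) (isZero y , lookup g (proj₂ (candidate f y)))

test-improves : ∀ ds u d v →
  test (classOf ds) (classOf (reflect u)) (end 0F u ▷ d) (classOf v) ≡ improves (run q₀ ds) (result u d v)
test-improves ds u d v = cong₂ improves (run-class ds q₀)
  (trans (cong (isZero y ,_) (run-class v (proj₂ (candidate (classOf (reflect u)) y)))) (continue-candidate u d v))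
  where
  y : Fin 3
  y = end 0F u ▷ d

normalized-id : ∀ {s} → Normalized s → normalize s ≡ s
normalized-id []                       = refl
normalized-id [-]                      = refl
normalized-id (_∷_ {xs = xs} x≢y rest) =
  trans (List.derun-accept ℕ._≟_ xs x≢y) (cong (_ ∷_) (normalized-id rest))

ternary : ∀ {s} → All (_< 3) s → ∃[ w ] s ≡ map (toℕ {3}) w
ternary []            = [] , refl
ternary (m<3 ∷ s<3) with ternary s<3
... | w , refl = fromℕ< m<3 ∷ w , cong (_∷ map toℕ w) (sym (Fin.toℕ-fromℕ< m<3))

fully-ternary : ∀ {s} → Normalized s → Fully 3 -ary s →
  ∃[ x ] ∃[ ds ] (s ≡ str x ds × #symbols s ≡ 3)
fully-ternary {s} norm full with ternary (All.tabulate (λ {y} → Equivalence.to (full y)))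
... | [] , refl with Equivalence.from (full 0) (s≤s z≤n)
...   | ()
fully-ternary norm full | x ∷ w , refl = x , diffs x w ,
  trans (sym (normalized-id norm)) (normalize-word x w) ,
  #symbols-unique {t = 0 ∷ 1 ∷ 2 ∷ []}
    (((λ ()) ∷ (λ ()) ∷ []) ∷ ((λ ()) ∷ []) ∷ [] ∷ []) ((λ {y} y∈ → below (Equivalence.to (full y) y∈)) , λ {y} y∈ → Equivalence.from (full y) (small y∈))
  where
  below : ∀ {y} → y < 3 → y ∈ 0 ∷ 1 ∷ 2 ∷ []
  below {0} _ = here refl
  below {1} _ = there (here refl)
  below {2} _ = there (there (here refl))
  below {suc (suc (suc _))} (s≤s (s≤s (s≤s ())))
  small : ∀ {y} → y ∈ 0 ∷ 1 ∷ 2 ∷ [] → y < 3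
  small (here refl)                 = s≤s z≤n
  small (there (here refl))         = s≤s (s≤s z≤n)
  small (there (there (here refl))) = s≤s (s≤s (s≤s z≤n))

distance-by-weight : ∀ x ds k → kind (run q₀ ds) ≡ k → #symbols (str x ds) ≡ 3 →
  IsGroupingDistance 3 (str x ds) (length (str x ds) ∸ suc (weight k))
distance-by-weight x ds k refl syms = subst₂ (λ j n → IsGroupingDistance j (str x ds) n)
  -- By computation `value ds` is `suc (length ds) ∸ suc (κ (run q₀ ds))`; with weights 1 and 2 this
  -- gives the length minus 2 and minus 3.
  syms (cong (_∸ suc (κ (run q₀ ds))) (sym (length-str x ds))) (value-distance x ds)

ternary-distance : ∀ x ds → #symbols (str x ds) ≡ 3 →
  (Bad (str x ds) → IsGroupingDistance 3 (str x ds) (length (str x ds) ∸ 2)) ×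
  (¬ Bad (str x ds) → IsGroupingDistance 3 (str x ds) (length (str x ds) ∸ 3))
ternary-distance x ds syms = go (kind (run q₀ ds)) refl (ℕ.suc-injective (trans (sym (#symbols-str x ds)) syms))
  where
  go : ∀ k → kind (run q₀ ds) ≡ k → rank (kind (run q₀ ds)) ≡ 2 →
    (Bad (str x ds) → IsGroupingDistance 3 (str x ds) (length (str x ds) ∸ 2)) ×
    (¬ Bad (str x ds) → IsGroupingDistance 3 (str x ds) (length (str x ds) ∸ 3))
  go unary  eq rank≡2 with trans (sym (cong rank eq)) rank≡2
  ... | ()
  go binary eq rank≡2 with trans (sym (cong rank eq)) rank≡2
  ... | ()
  go bad    eq _ = (λ _ → distance-by-weight x ds bad eq syms) , λ ¬bad → contradiction (kind-bad x ds eq) ¬bad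
  go good   eq _ = (λ isBad → contradiction isBad (kind-good x ds eq)) , λ _ → distance-by-weight x ds good eq syms

-- The coding of classes stays abstract, so the number 48 ^ 48 enters only when the theorem is
-- assembled.
module _ {m : ℕ} (code : Class → Fin m) (decode : Fin m → Class) (decode-code : ∀ c → decode (code c) ≡ c) where

  open Machine code decode decode-code (Vec.allFin 48) prepend test value

  decreasing : Decreasing
  decreasing u d v ok = value-improves u d v (trans (sym (test-improves (u ++ d ∷ v) u d v)) ok)

  -- The program may stop only when no flip passes the test; by `flip-improves` this happens only at
  -- value 0, so stopping means being grouped.
  chosen-improving : ∀ {ds is} → Chosen ds is → Improving ds is
  chosen-improving {ds} (stop none) = done (ℕ.m≤n⇒m∸n≡0 (ℕ.≮⇒≥ stuck))
    where
    stuck : ¬ κ (run q₀ ds) < length ds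
    stuck κ< with flip-improves ds κ<
    ... | u , d , v , eq , better with trans (sym (none u d v eq)) (trans (test-improves ds u d v) better)
    ...   | ()
  chosen-improving {ds} (next u d v eq ok rest) =
    step u d v eq (trans (sym (test-improves ds u d v)) ok) (chosen-improving rest)

  solves-optimal : ∀ w is → Solves w is → OptimallyGroups w is
  solves-optimal []      _  refl   = ([] , [] , refl) , ([] , ([] , [] , refl) , refl) , λ _ _ → z≤n
  solves-optimal (x ∷ w) is chosen = subst₂ (λ k s → GroupsTo k s is × IsGroupingDistance k s (length is))
    (trans (cong #symbols (sym (normalize-word x w))) (#symbols-cong (normalize-≐ (map toℕ (x ∷ w)))))
    (sym (normalize-word x w))
    (improving-groups imp x ,
     subst (IsGroupingDistance (#symbols (str x ds)) (str x ds)) (sym (improving-length imp)) (value-distance x ds))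
    where
    ds : List Bool
    ds = diffs x w
    imp : Improving ds is
    imp = chosen-improving chosen

  optimal-computable : PolyTimeComputable OptimallyGroups
  optimal-computable = 7 , m , program , 45 , 2 , λ w → computes w (program-run decreasing (λ ds → ℕ.m∸n≤m (length ds) (κ (run q₀ ds))) w)
    where
    computes : ∀ w →
      ∃[ is ] ∃[ t ] ∃[ τ ] (⟨ program , initial 7 m w ⟩⇓[ t ] τ × t ≤ 45 * length w ^ 2 + 45 ×
        Vec.head τ ≡ encode m is × Solves w is) →
      ∃[ is ] ∃[ t ] ∃[ τ ] (⟨ program , initial 7 m w ⟩⇓[ t ] τ × t ≤ 45 * length w ^ 2 + 45 ×
        Vec.head τ ≡ encode m is × OptimallyGroups w is)
    computes w (is , t , τ , trace , time , out , solves) =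
      is , t , τ , trace , time , out , solves-optimal w is solves

class-code : Class → Fin (48 ^ 48)
class-code c = funToFin (lookup c)

class-decode : Fin (48 ^ 48) → Class
class-decode k = Vec.tabulate (finToFun k)

decode-class-code : ∀ c → class-decode (class-code c) ≡ c
decode-class-code c = trans (Vec.tabulate-cong (Fin.finToFun-funToFin (lookup c))) (Vec.tabulate∘lookup c)

theorem3p6 : (∀ (s : Str) → Normalized s → Fully 3 -ary s →
    (Bad s → IsGroupingDistance 3 s (length s ∸ 2)) ×
    (¬ Bad s → IsGroupingDistance 3 s (length s ∸ 3)))
    × PolyTimeComputable OptimallyGroups
theorem3p6 = distances , optimal-computable class-code class-decode decode-class-code
  where
  distances : ∀ (s : Str) → Normalized s → Fully 3 -ary s →
    (Bad s → IsGroupingDistance 3 s (length s ∸ 2)) ×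
    (¬ Bad s → IsGroupingDistance 3 s (length s ∸ 3))
  distances s norm full with fully-ternary norm full
  ... | x , ds , refl , syms = ternary-distance x ds syms
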